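{- Let $G$ be a finite simple graph with $\operatorname{mad}(G) < 25/4$. Then $\tau(G) \leq 2\nu(G)$.
   Context: $\nu(G)$ is the maximum number of pairwise edge-disjoint triangles in $G$. $\tau(G)$ is the minimum size of an edge set $Y \subseteq E(G)$ such that $G - Y$ is triangle-free. The maximum average degree is $\operatorname{mad}(G) = \max\{2|E(H)|/|V(H)| : H \subseteq G,\ V(H)\neq\emptyset\}$. -}

module Defs where

open import Data.Fin.Base using (Fin; _<_)
open import Data.Fin.Properties using (_≟_; _<?_; any?)
open import Data.Integer.Base using (+_)
open import Data.List.Base using (List; []; _∷_; _++_; map; filter; mapMaybe; length; allFin; cartesianProduct)
open import Data.List.Extrema.Nat using () renaming (max to maxℕ; min to minℕ)
open import Data.List.Membership.Propositional using (_∈_; _∉_)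
open import Data.List.NonEmpty.Base as List⁺ using (List⁺)
open import Data.List.Relation.Binary.Disjoint.Propositional using (Disjoint)
open import Data.List.Relation.Unary.All using (All; all?)
open import Data.List.Relation.Unary.AllPairs using (AllPairs; allPairs?)
open import Data.Nat.Base using (ℕ; _*_)
open import Data.Product.Base using (∃; _×_; _,_)
open import Data.Product.Properties using (≡-dec)
open import Data.Rational.Base using (ℚ; 0ℚ; _/_)
open import Data.Rational.Properties using (≤-decTotalOrder)
open import Level using (0ℓ)
open import Relation.Binary.Bundles using (module DecTotalOrder)
open import Relation.Binary.Core using (Rel)
open import Relation.Binary.Definitions using (Decidable; DecidableEquality; Symmetric)
open import Relation.Nullary using (¬_; Dec; ¬?; _×-dec_)
import Data.List.Extrema
import Data.List.Membership.DecPropositional as DecMembership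
import Data.List.Relation.Binary.Disjoint.DecPropositional as DecDisjoint

private
  variable
    n : ℕ
    A : Set

record SimpleGraph (n : ℕ) : Set₁ where
  infix 4 _~_ _~?_
  field
    _~_      : Rel (Fin n) 0ℓ
    _~?_     : Decidable _~_
    ~-sym    : Symmetric _~_
    ~-irrefl : ∀ {v} → ¬ (v ~ v)

-- The edge {u, v} is encoded as the ordered pair (u , v) with u < v, so that
-- each edge has exactly one representative.
Edge : ℕ → Set
Edge n = Fin n × Fin n

_≟ᴱ_ : DecidableEquality (Edge n)
_≟ᴱ_ = ≡-dec _≟_ _≟_

private
  module DecFin {n} = DecMembership (_≟_ {n})
  module DecEdge {n} = DecMembership (_≟ᴱ_ {n})
  module DecEdgeDisjoint {n} = DecDisjoint (_≟ᴱ_ {n})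

-- All subsets of the set listed by a duplicate-free list; each subset occurs
-- once, as a duplicate-free list, so its cardinality is its length.
sublists : List A → List (List A)
sublists []       = [] ∷ []
sublists (x ∷ xs) = map (x ∷_) (sublists xs) ++ sublists xs

module _ (G : SimpleGraph n) where
  open SimpleGraph G

  IsEdge : Edge n → Set
  IsEdge (u , v) = u < v × u ~ v

  isEdge? : ∀ e → Dec (IsEdge e)
  isEdge? (u , v) = u <? v ×-dec u ~? v

  edges : List (Edge n)
  edges = filter isEdge? (cartesianProduct (allFin n) (allFin n))

  TriangleFree : Set
  TriangleFree = ¬ ∃ λ a → ∃ λ b → ∃ λ c → a ~ b × b ~ c × a ~ c

  triangleFree? : Dec TriangleFree
  triangleFree? = ¬? (any? λ a → any? λ b → any? λ c →
    a ~? b ×-dec b ~? c ×-dec a ~? c)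

infixl 6 _-ᴱ_

-- Y may contain either orientation of a pair; both remove the edge.
_-ᴱ_ : SimpleGraph n → List (Edge n) → SimpleGraph n
G -ᴱ Y = record
  { _~_      = λ u v → u ~ v × (u , v) ∉ Y × (v , u) ∉ Y
  ; _~?_     = λ u v →
      u ~? v ×-dec (u , v) DecEdge.∉? Y ×-dec (v , u) DecEdge.∉? Y
  ; ~-sym    = λ (uv , uv∉Y , vu∉Y) → ~-sym uv , vu∉Y , uv∉Y
  ; ~-irrefl = λ (vv , _) → ~-irrefl vv
  }
  where open SimpleGraph G

-- The triangle on {a, b, c} is encoded as (a , b , c) with a < b < c; in the
-- list of triangles below, IsEdge enforces this order.
Triangle : ℕ → Set
Triangle n = Fin n × Fin n × Fin n

triangleEdges : Triangle n → List (Edge n)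
triangleEdges (a , b , c) = (a , b) ∷ (b , c) ∷ (a , c) ∷ []

EdgeDisjoint : Rel (Triangle n) 0ℓ
EdgeDisjoint s t = Disjoint (triangleEdges s) (triangleEdges t)

edgeDisjoint? : Decidable (EdgeDisjoint {n})
edgeDisjoint? s t = DecEdgeDisjoint.disjoint? (triangleEdges s) (triangleEdges t)

module _ (G : SimpleGraph n) where

  triangles : List (Triangle n)
  triangles = filter (λ t → all? (isEdge? G) (triangleEdges t))
    (cartesianProduct (allFin n) (cartesianProduct (allFin n) (allFin n)))

  -- The default 0 is attained by the empty family of triangles.
  ν : ℕ
  ν = maxℕ 0 (map length
    (filter (allPairs? edgeDisjoint?) (sublists triangles)))

  -- The default |E(G)| is attained by Y = E(G).
  τ : ℕ
  τ = minℕ (length (edges G)) (map length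
    (filter (λ Y → triangleFree? (G -ᴱ Y)) (sublists (edges G))))

-- A candidate subgraph with nonempty vertex set: its vertices and its edges.
PreSubgraph : ℕ → Set
PreSubgraph n = List⁺ (Fin n) × List (Edge n)

EndpointsIn : List (Fin n) → Edge n → Set
EndpointsIn W (u , v) = u ∈ W × v ∈ W

endpointsIn? : (W : List (Fin n)) (e : Edge n) → Dec (EndpointsIn W e)
endpointsIn? W (u , v) = u DecFin.∈? W ×-dec v DecFin.∈? W

IsGraph : PreSubgraph n → Set
IsGraph (W , F) = All (EndpointsIn (List⁺.toList W)) F

isGraph? : (H : PreSubgraph n) → Dec (IsGraph H)
isGraph? (W , F) = all? (endpointsIn? (List⁺.toList W)) F

averageDegree : PreSubgraph n → ℚ
averageDegree (W , F) = + (2 * length F) / List⁺.length W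

module _ (G : SimpleGraph n) where

  -- All subgraphs of G (not only the induced ones) with nonempty vertex set.
  nonemptySubgraphs : List (PreSubgraph n)
  nonemptySubgraphs = filter isGraph? (cartesianProduct
    (mapMaybe List⁺.fromList (sublists (allFin n)))
    (sublists (edges G)))

  -- Average degrees are nonnegative, so the default 0 only matters for the
  -- graph without vertices, whose maximum average degree is taken to be 0.
  mad : ℚ
  mad = Data.List.Extrema.max (DecTotalOrder.totalOrder ≤-decTotalOrder) 0ℚ
    (map averageDegree nonemptySubgraphs)

{-# OPTIONS --safe #-}
-- Call G reducible if some nonempty set F of edges contains the sides of k
-- edge-disjoint triangles while at most 2k edges hit all triangles of G that
-- meet F: a packing and a cover of G - F with |cover| ≤ 2 |packing| then extend
-- to G.  So let G be irreducible.
--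
-- If the graph induced on the neighbours of v has a matching M and a vertex
-- cover of the remaining edges of size |M|, then G is reducible at v; a case
-- distinction shows that all non-isolated vertices have degree at least 5, and
-- that the complement of the neighbourhood of a vertex of degree at most 6, a
-- low vertex, is a matching.  Two adjacent low vertices are reducible too,
-- hence the low vertices are independent.  A vertex with a low neighbour has at
-- least three neighbours that are not low, and if it has exactly three then it
-- has at most two low ones.  So if every low vertex takes 1/4 from each of its
-- neighbours, then every non-isolated vertex ends up with at least 25/4, and
-- mad G ≥ 25/4 unless G has no edges.
module Submission where

open import Defs
open import Data.Bool.Base using (true; false; if_then_else_)
open import Data.Empty using (⊥; ⊥-elim)
open import Data.Fin.Base as Fin using (Fin)
open import Data.Fin.Patterns
import Data.Fin.Properties as Fin
open import Data.Integer.Base as ℤ using (+_)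
import Data.Integer.Properties as ℤ
open import Data.List.Base
  using (List; []; _∷_; _++_; map; mapMaybe; tabulate; filter; length; lookup; allFin;
         cartesianProduct)
import Data.List.Extrema
import Data.List.Extrema.Nat as Extrema
import Data.List.Membership.DecPropositional as DecMembership
open import Data.List.Membership.Propositional using (_∈_; _∉_; find)
open import Data.List.Membership.Propositional.Properties
import Data.List.NonEmpty.Base as List⁺
open import Data.List.Properties using (length-++; length-map; filter-++; filter-reject)
import Data.List.Relation.Binary.Disjoint.DecPropositional as DecDisjoint
open import Data.List.Relation.Binary.Disjoint.Propositional using (Disjoint)
open import Data.List.Relation.Binary.Pointwise as Pointwise using (Pointwise; []; _∷_)
open import Data.List.Relation.Binary.Subset.Propositional using (_⊆_)
open import Data.List.Relation.Unary.All as All using (All; []; _∷_)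
import Data.List.Relation.Unary.All.Properties as All
open import Data.List.Relation.Unary.AllPairs as AllPairs using (AllPairs; []; _∷_)
import Data.List.Relation.Unary.AllPairs.Properties as AllPairs
open import Data.List.Relation.Unary.Any as Any using (Any; here; there)
import Data.List.Relation.Unary.Any.Properties as Any
open import Data.List.Relation.Unary.Unique.Propositional using (Unique)
import Data.List.Relation.Unary.Unique.Propositional.Properties as Unique
import Data.Maybe.Relation.Unary.Any as Maybe
open import Data.Nat.Base as ℕ using (ℕ; suc; _≤_; z≤n; s≤s; _+_; _*_)
open import Data.Nat.Induction using (<-wellFounded)
import Data.Nat.Properties as ℕ
open import Data.Product.Base using (∃; _×_; _,_; proj₁; proj₂; swap; uncurry)
open import Data.Product.Properties using (≡-dec)
open import Data.Rational.Base using (_<_; _/_; fromℚᵘ; toℚᵘ) renaming (_≤_ to _≤ℚ_)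
import Data.Rational.Properties as ℚ
open import Data.Rational.Unnormalised.Base using (mkℚᵘ; *≤*)
import Data.Rational.Unnormalised.Properties as ℚᵘ
open import Data.Sum.Base as Sum using (_⊎_; inj₁; inj₂)
open import Function.Base using (_∘_; id; case_of_)
open import Induction.WellFounded using (Acc; acc)
open import Level using (0ℓ)
open import Relation.Binary.Bundles using (module DecTotalOrder)
open import Relation.Binary.Core using (Rel)
open import Relation.Binary.Definitions using (DecidableEquality; Symmetric; tri<; tri≈; tri>)
open import Relation.Binary.PropositionalEquality
  using (_≡_; _≢_; refl; sym; trans; cong; cong₂; subst; subst₂; module ≡-Reasoning)
open import Relation.Nullary
  using (¬_; Dec; yes; no; does; contradiction; ¬?; _⊎-dec_; _×-dec_)
open import Relation.Nullary.Decidable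
  using (dec-true; dec-false; True; toWitness; decidable-stable; from-no)
open import Relation.Unary using (Pred; Decidable)

open import Algebra.Properties.CommutativeMonoid.Sum ℕ.+-0-commutativeMonoid
  using (sum; sum-syntax; sum-cong-≗; ∑-distrib-+; ∑-comm)
open import Algebra.Properties.Semiring.Sum ℕ.+-*-semiring using (*-distribˡ-sum)

private
  variable
    n : ℕ
    A : Set
    x y : A
    xs ys : List A

-- Duplicate-free lists, counting and fractions

unique-⊆⇒length≤ : Unique xs → xs ⊆ ys → length xs ≤ length ys
unique-⊆⇒length≤ [] _ = z≤n
unique-⊆⇒length≤ {xs = x ∷ xs} (x∉xs ∷ u) sub with ∈-∃++ (sub (here refl))
... | as , bs , refl = begin
  suc (length xs)           ≤⟨ s≤s (unique-⊆⇒length≤ u sub′) ⟩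
  suc (length (as ++ bs))   ≡⟨ cong suc (length-++ as) ⟩
  suc (length as + length bs) ≡⟨ ℕ.+-suc (length as) (length bs) ⟨
  length as + suc (length bs) ≡⟨ length-++ as ⟨
  length (as ++ x ∷ bs)     ∎
  where
  open ℕ.≤-Reasoning
  sub′ : xs ⊆ as ++ bs
  sub′ z∈xs with ∈-++⁻ as (sub (there z∈xs))
  ... | inj₁ z∈as = ∈-++⁺ˡ z∈as
  ... | inj₂ (here refl) = contradiction refl (All.lookup x∉xs z∈xs)
  ... | inj₂ (there z∈bs) = ∈-++⁺ʳ as z∈bs

unique-⊆-length≥⇒⊇ : DecidableEquality A → {xs ys : List A} →
  Unique xs → xs ⊆ ys → length ys ≤ length xs → ys ⊆ xs
unique-⊆-length≥⇒⊇ _≟_ {xs} u sub len {y} y∈ys with DecMembership._∈?_ _≟_ y xs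
... | yes y∈xs = y∈xs
... | no  y∉xs = contradiction (ℕ.≤-trans longer len) ℕ.1+n≰n
  where
  longer : suc (length xs) ≤ _
  longer = unique-⊆⇒length≤ (All.¬Any⇒All¬ xs y∉xs ∷ u) λ where
    (here refl)  → y∈ys
    (there z∈xs) → sub z∈xs

-- Members of `sublists xs` keep the order of `xs`, so a subset known in another order has to be
-- exhibited as a filter of `xs`.
filter-∈-sublists : {P : Pred A 0ℓ} (P? : Decidable P) (xs : List A) →
  filter P? xs ∈ sublists xs
filter-∈-sublists P? [] = here refl
filter-∈-sublists P? (x ∷ xs) with does (P? x)
... | true  = ∈-++⁺ˡ (∈-map⁺ (x ∷_) (filter-∈-sublists P? xs))
... | false = ∈-++⁺ʳ (map (x ∷_) (sublists xs)) (filter-∈-sublists P? xs)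

-- Together with `allPairs-lookup` this carries a symmetric relation over to a duplicate-free list
-- that has the elements in another order.
unique⇒allPairs : {R : Rel A 0ℓ} → Unique xs →
  (∀ {x y} → x ∈ xs → y ∈ xs → x ≢ y → R x y) → AllPairs R xs
unique⇒allPairs [] _ = []
unique⇒allPairs (x∉xs ∷ u) r =
  All.tabulate (λ y∈xs → r (here refl) (there y∈xs) (All.lookup x∉xs y∈xs)) ∷
  unique⇒allPairs u (λ x∈xs y∈xs → r (there x∈xs) (there y∈xs))

allPairs-lookup : {R : Rel A 0ℓ} → Symmetric R → AllPairs R xs →
  x ∈ xs → y ∈ xs → x ≢ y → R x y
allPairs-lookup R-sym (_ ∷ _) (here refl) (here refl) x≢x = contradiction refl x≢x
allPairs-lookup R-sym (r ∷ _) (here refl) (there y∈xs) _ = All.lookup r y∈xs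
allPairs-lookup R-sym (r ∷ _) (there x∈xs) (here refl) _ = R-sym (All.lookup r x∈xs)
allPairs-lookup R-sym (_ ∷ rs) (there x∈xs) (there y∈xs) x≢y =
  allPairs-lookup R-sym rs x∈xs y∈xs x≢y

unique-⊆-⊇⇒length≡ : Unique xs → Unique ys → xs ⊆ ys → ys ⊆ xs → length xs ≡ length ys
unique-⊆-⊇⇒length≡ ux uy xs⊆ys ys⊆xs =
  ℕ.≤-antisym (unique-⊆⇒length≤ ux xs⊆ys) (unique-⊆⇒length≤ uy ys⊆xs)

lookup-injective : Unique xs → ∀ {i j} → lookup xs i ≡ lookup xs j → i ≡ j
lookup-injective (_ ∷ _)    {Fin.zero}  {Fin.zero}  _  = refl
lookup-injective (x∉xs ∷ _) {Fin.zero}  {Fin.suc j} eq =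
  contradiction eq (All.lookup x∉xs (∈-lookup j))
lookup-injective (x∉xs ∷ _) {Fin.suc i} {Fin.zero}  eq =
  contradiction (sym eq) (All.lookup x∉xs (∈-lookup i))
lookup-injective (_ ∷ u)    {Fin.suc i} {Fin.suc j} eq = cong Fin.suc (lookup-injective u eq)

∈⇒lookup : x ∈ xs → ∃ λ i → x ≡ lookup xs i
∈⇒lookup x∈xs = Any.index x∈xs , Any.lookup-index x∈xs

𝟙 : {P : Set} → Dec P → ℕ
𝟙 P? = if does P? then 1 else 0

sum-mono-≤ : ∀ {k} {f g : Fin k → ℕ} → (∀ i → f i ≤ g i) → sum f ≤ sum g
sum-mono-≤ {ℕ.zero}  f≤g = z≤n
sum-mono-≤ {suc k} f≤g = ℕ.+-mono-≤ (f≤g Fin.zero) (sum-mono-≤ (f≤g ∘ Fin.suc))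

length-filter-tabulate : ∀ {k} {P : Pred A 0ℓ} (P? : Decidable P) (f : Fin k → A) →
  length (filter P? (tabulate f)) ≡ ∑[ i < k ] 𝟙 (P? (f i))
length-filter-tabulate {k = ℕ.zero} P? f = refl
length-filter-tabulate {k = suc k} P? f with does (P? (f Fin.zero))
... | true  = cong suc (length-filter-tabulate P? (f ∘ Fin.suc))
... | false = length-filter-tabulate P? (f ∘ Fin.suc)

length-filter-map : {B : Set} {P : Pred B 0ℓ} (P? : Decidable P) (f : A → B) (xs : List A) →
  length (filter P? (map f xs)) ≡ length (filter (P? ∘ f) xs)
length-filter-map P? f [] = refl
length-filter-map P? f (x ∷ xs) with does (P? (f x))
... | true  = cong suc (length-filter-map P? f xs)
... | false = length-filter-map P? f xs

length-filter-cartesianProduct : ∀ {k} {B : Set} {P : Pred (A × B) 0ℓ} (P? : Decidable P)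
  (f : Fin k → A) (ys : List B) →
  length (filter P? (cartesianProduct (tabulate f) ys)) ≡
  ∑[ i < k ] length (filter (λ y → P? (f i , y)) ys)
length-filter-cartesianProduct {k = ℕ.zero} P? f ys = refl
length-filter-cartesianProduct {k = suc k} P? f ys = begin
  length (filter P? (map (f Fin.zero ,_) ys ++ rest))
    ≡⟨ cong length (filter-++ P? (map (f Fin.zero ,_) ys) rest) ⟩
  length (filter P? (map (f Fin.zero ,_) ys) ++ filter P? rest)
    ≡⟨ length-++ (filter P? (map (f Fin.zero ,_) ys)) ⟩
  length (filter P? (map (f Fin.zero ,_) ys)) + length (filter P? rest)
    ≡⟨ cong₂ _+_ (length-filter-map P? (f Fin.zero ,_) ys)
         (length-filter-cartesianProduct P? (f ∘ Fin.suc) ys) ⟩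
  _ ∎
  where
  open ≡-Reasoning
  rest = cartesianProduct (tabulate (f ∘ Fin.suc)) ys

-- Presents the edges of a subgraph as a filter of the edges of the larger graph, hence as one of
-- its `sublists`.
filter-filter : {P Q : Pred A 0ℓ} (P? : Decidable P) (Q? : Decidable Q) →
  (∀ {x} → P x → Q x) → ∀ xs → filter P? (filter Q? xs) ≡ filter P? xs
filter-filter P? Q? P⇒Q [] = refl
filter-filter P? Q? P⇒Q (x ∷ xs) with Q? x
... | no ¬q = trans (filter-filter P? Q? P⇒Q xs) (sym (filter-reject P? (¬q ∘ P⇒Q)))
... | yes _ with does (P? x)
...   | true  = cong (x ∷_) (filter-filter P? Q? P⇒Q xs)
...   | false = filter-filter P? Q? P⇒Q xs

-- `_/_` cancels common factors, so the comparison is made on unnormalised fractions, where it is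
-- cross-multiplication.
/-mono-≤ : ∀ p q d e → p * suc e ≤ q * suc d → (+ p / suc d) ≤ℚ (+ q / suc e)
/-mono-≤ p q d e h = ℚ.toℚᵘ-cancel-≤ (begin
  toℚᵘ (fromℚᵘ (mkℚᵘ (+ p) d)) ≃⟨ ℚ.toℚᵘ-fromℚᵘ (mkℚᵘ (+ p) d) ⟩
  mkℚᵘ (+ p) d                 ≤⟨ *≤* (subst₂ ℤ._≤_ (ℤ.pos-* p (suc e)) (ℤ.pos-* q (suc d))
                                    (ℤ.+≤+ h)) ⟩
  mkℚᵘ (+ q) e                 ≃⟨ ℚ.toℚᵘ-fromℚᵘ (mkℚᵘ (+ q) e) ⟨
  toℚᵘ (fromℚᵘ (mkℚᵘ (+ q) e)) ∎)
  where open ℚᵘ.≤-Reasoning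

-- Packings, covers and reductions

module _ {n : ℕ} where
  open DecMembership (_≟ᴱ_ {n}) public using () renaming (_∈?_ to _∈ᴱ?_)

infix 4 _∈ᵁ_ _∈ᵁ?_

_∈ᵁ_ : Edge n → List (Edge n) → Set
e ∈ᵁ Y = e ∈ Y ⊎ swap e ∈ Y

_∈ᵁ?_ : (e : Edge n) (Y : List (Edge n)) → Dec (e ∈ᵁ Y)
e ∈ᵁ? Y = e ∈ᴱ? Y ⊎-dec swap e ∈ᴱ? Y

∈ᵁ-mono : {e : Edge n} {X Y : List (Edge n)} → X ⊆ Y → e ∈ᵁ X → e ∈ᵁ Y
∈ᵁ-mono X⊆Y = Sum.map X⊆Y X⊆Y

∈ᵁ-++⁻ : {e : Edge n} (X : List (Edge n)) {Y : List (Edge n)} → e ∈ᵁ X ++ Y → e ∈ᵁ X ⊎ e ∈ᵁ Y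
∈ᵁ-++⁻ X (inj₁ p) = Sum.map inj₁ inj₁ (∈-++⁻ X p)
∈ᵁ-++⁻ X (inj₂ p) = Sum.map inj₂ inj₂ (∈-++⁻ X p)

-- Both orientations are listed, so that disjointness of sides means edge-disjointness even for
-- triangles whose vertices are not sorted.
sides : Triangle n → List (Edge n)
sides t = triangleEdges t ++ map swap (triangleEdges t)

SideDisjoint : Rel (Triangle n) 0ℓ
SideDisjoint s t = Disjoint (sides s) (sides t)

∈-sides⁻ : {e : Edge n} (t : Triangle n) → e ∈ sides t → e ∈ᵁ triangleEdges t
∈-sides⁻ t e∈t with ∈-++⁻ (triangleEdges t) e∈t
... | inj₁ p = inj₁ p
... | inj₂ p with ∈-map⁻ swap p
...   | _ , q , refl = inj₂ q

∈ᵁ-sides : {F : List (Edge n)} {e : Edge n} {t : Triangle n} →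
  All (_∈ᵁ F) (triangleEdges t) → e ∈ sides t → e ∈ᵁ F
∈ᵁ-sides {t = t} t∈F e∈t with ∈-sides⁻ t e∈t
... | inj₁ p = All.lookup t∈F p
... | inj₂ p = Sum.swap (All.lookup t∈F p)

module _ (G : SimpleGraph n) where
  open SimpleGraph G

  IsTriangle : Triangle n → Set
  IsTriangle (a , b , c) = a ~ b × b ~ c × a ~ c

  -- A witness of τ ≤ 2ν whose triangles are unsorted and whose cover may contain pairs that are no
  -- edges; such witnesses extend along a `Reduction` by concatenation.
  record TuzaPair : Set where
    field
      packing          : List (Triangle n)
      cover            : List (Edge n)
      packing-⊆        : All IsTriangle packing
      packing-disjoint : AllPairs SideDisjoint packing
      cover-covers     : TriangleFree (G -ᴱ cover)
      cover-small      : length cover ≤ 2 * length packing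

  -- The conditions under which τ G ≤ 2 ν G follows from τ G′ ≤ 2 ν G′ for
  -- G′ = G -ᴱ removed: add family to a packing and hitting to a cover of G′.
  record Reduction : Set where
    field
      family          : List (Triangle n)
      hitting         : List (Edge n)
      removed         : List (Edge n)
      family-⊆        : All IsTriangle family
      family-disjoint : AllPairs SideDisjoint family
      family-removed  : All (λ t → All (_∈ᵁ removed) (triangleEdges t)) family
      hitting-small   : length hitting ≤ 2 * length family
      removed-hit     : ∀ {a b c} → IsTriangle (a , b , c) →
        ¬ ((a , b) ∈ᵁ hitting) → ¬ ((b , c) ∈ᵁ hitting) → ¬ ((a , c) ∈ᵁ hitting) →
        ¬ ((a , b) ∈ᵁ removed)
      removed-edge    : ∃ λ e → e ∈ removed × uncurry _~_ e

-- Witnesses and the numbers `ν` and `τ`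

module _ {G : SimpleGraph n} where
  open SimpleGraph G

  ~⇒∉ᵁ : ∀ {Y u v} → SimpleGraph._~_ (G -ᴱ Y) u v → ¬ ((u , v) ∈ᵁ Y)
  ~⇒∉ᵁ (_ , uv∉Y , vu∉Y) = Sum.[ uv∉Y , vu∉Y ]

  SortedAs : Triangle n → Triangle n → Set
  SortedAs t t′ = All (IsEdge G) (triangleEdges t′) × All (_∈ sides t) (triangleEdges t′)

  private
    -- Positions in `sides (a , b , c)`: ab, bc, ac, ba, cb, ca.
    pattern e₀ = here refl
    pattern e₁ = there e₀
    pattern e₂ = there e₁
    pattern e₃ = there e₂
    pattern e₄ = there e₃
    pattern e₅ = there e₄

  -- `ν` only sees increasing triples. Of the eight outcomes of the three strict comparisons, the
  -- two cyclic ones are impossible.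
  sort-triangle : ∀ t → IsTriangle G t → ∃ (SortedAs t)
  sort-triangle t@(a , b , c) (ab , bc , ac)
    with Fin.<-cmp a b | Fin.<-cmp b c | Fin.<-cmp a c
  ... | tri≈ _ refl _ | _ | _ = contradiction ab ~-irrefl
  ... | _ | tri≈ _ refl _ | _ = contradiction bc ~-irrefl
  ... | _ | _ | tri≈ _ refl _ = contradiction ac ~-irrefl
  ... | tri< a<b _ _ | tri< b<c _ _ | tri< a<c _ _ =
    (a , b , c) , (a<b , ab) ∷ (b<c , bc) ∷ (a<c , ac) ∷ [] ,
    e₀ ∷ e₁ ∷ e₂ ∷ []
  ... | tri< a<b _ _ | tri< b<c _ _ | tri> _ _ c<a =
    contradiction (Fin.<-trans a<b b<c) (Fin.<-asym c<a)
  ... | tri< a<b _ _ | tri> _ _ c<b | tri< a<c _ _ =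
    (a , c , b) , (a<c , ac) ∷ (c<b , ~-sym bc) ∷ (a<b , ab) ∷ [] ,
    e₂ ∷ e₄ ∷ e₀ ∷ []
  ... | tri< a<b _ _ | tri> _ _ c<b | tri> _ _ c<a =
    (c , a , b) , (c<a , ~-sym ac) ∷ (a<b , ab) ∷ (c<b , ~-sym bc) ∷ [] ,
    e₅ ∷ e₀ ∷ e₄ ∷ []
  ... | tri> _ _ b<a | tri< b<c _ _ | tri< a<c _ _ =
    (b , a , c) , (b<a , ~-sym ab) ∷ (a<c , ac) ∷ (b<c , bc) ∷ [] ,
    e₃ ∷ e₂ ∷ e₁ ∷ []
  ... | tri> _ _ b<a | tri< b<c _ _ | tri> _ _ c<a =
    (b , c , a) , (b<c , bc) ∷ (c<a , ~-sym ac) ∷ (b<a , ~-sym ab) ∷ [] ,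
    e₁ ∷ e₅ ∷ e₃ ∷ []
  ... | tri> _ _ b<a | tri> _ _ c<b | tri< a<c _ _ =
    contradiction (Fin.<-trans c<b b<a) (Fin.<-asym a<c)
  ... | tri> _ _ b<a | tri> _ _ c<b | tri> _ _ c<a =
    (c , b , a) , (c<b , ~-sym bc) ∷ (b<a , ~-sym ab) ∷ (c<a , ~-sym ac) ∷ [] ,
    e₄ ∷ e₃ ∷ e₅ ∷ []

  sort-family : ∀ {S} → All (IsTriangle G) S → ∃ (Pointwise SortedAs S)
  sort-family [] = [] , []
  sort-family (t ∷ S) =
    let t′ , p = sort-triangle _ t ; S′ , ps = sort-family S in t′ ∷ S′ , p ∷ ps

  sort-disjoint : ∀ {S S′} → Pointwise SortedAs S S′ →
    AllPairs SideDisjoint S → AllPairs EdgeDisjoint S′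
  sort-disjoint [] [] = []
  sort-disjoint ((_ , t′⊆t) ∷ ps) (d ∷ ds) = first ps d ∷ sort-disjoint ps ds
    where
    first : ∀ {S S′} → Pointwise SortedAs S S′ → All (SideDisjoint _) S → All (EdgeDisjoint _) S′
    first [] [] = []
    first ((_ , s′⊆s) ∷ ps) (d ∷ ds) =
      (λ (e∈t′ , e∈s′) → d (All.lookup t′⊆t e∈t′ , All.lookup s′⊆s e∈s′)) ∷ first ps ds

  -- Sorting the triangles of `S` gives `S′`, and filtering `triangles G` by membership in `S′`
  -- gives a sublist `T` with the same elements. No length is lost: `S′` has no duplicates, since no
  -- triangle is edge-disjoint from itself.
  ν-bound : ∀ {S} → All (IsTriangle G) S → AllPairs SideDisjoint S → length S ≤ ν G
  ν-bound {S} S⊆ dis = ℕ.≤-trans S≤T (All.lookup (Extrema.xs≤max 0 _) (∈-map⁺ length T∈))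
    where
    S′ = proj₁ (sort-family S⊆)
    sorted = proj₂ (sort-family S⊆)
    dis′ = sort-disjoint sorted dis
    open DecMembership (≡-dec Fin._≟_ (≡-dec Fin._≟_ Fin._≟_)) using (_∈?_)
    T = filter (_∈? S′) (triangles G)
    isTri? = λ t → All.all? (isEdge? G) (triangleEdges t)
    T⊆S′ : ∀ {t} → t ∈ T → t ∈ S′
    T⊆S′ = proj₂ ∘ ∈-filter⁻ (_∈? S′) {xs = triangles G}
    T-unique : Unique T
    T-unique = Unique.filter⁺ _ (Unique.filter⁺ isTri?
      (Unique.cartesianProduct⁺ (Unique.allFin⁺ n)
        (Unique.cartesianProduct⁺ (Unique.allFin⁺ n) (Unique.allFin⁺ n))))
    S′⊆triangles : ∀ {S S′} → Pointwise SortedAs S S′ → S′ ⊆ triangles G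
    S′⊆triangles (_∷_ {y = a , b , c} (es , _) _) (here refl) =
      ∈-filter⁺ isTri? (∈-cartesianProduct⁺ (∈-allFin a)
        (∈-cartesianProduct⁺ (∈-allFin b) (∈-allFin c))) es
    S′⊆triangles (_ ∷ ps) (there t∈) = S′⊆triangles ps t∈
    T∈ : T ∈ filter (AllPairs.allPairs? edgeDisjoint?) (sublists (triangles G))
    T∈ = ∈-filter⁺ _ (filter-∈-sublists (_∈? S′) (triangles G))
      (unique⇒allPairs T-unique λ s∈ t∈ →
        allPairs-lookup {R = EdgeDisjoint} (λ d (p , q) → d (q , p)) dis′ (T⊆S′ s∈) (T⊆S′ t∈))
    S′-unique : Unique S′
    S′-unique = AllPairs.map (λ { d refl → d (here refl , here refl) }) dis′
    S≤T : length S ≤ length T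
    S≤T = begin
      length S  ≡⟨ Pointwise.Pointwise-length sorted ⟩
      length S′ ≤⟨ unique-⊆⇒length≤ S′-unique (λ t∈ →
                     ∈-filter⁺ (_∈? S′) (S′⊆triangles sorted t∈) t∈) ⟩
      length T  ∎
      where open ℕ.≤-Reasoning

  edges-unique : Unique (edges G)
  edges-unique = Unique.filter⁺ (isEdge? G)
    (Unique.cartesianProduct⁺ (Unique.allFin⁺ n) (Unique.allFin⁺ n))

  ∈-edges⁺ : ∀ {u v} → u Fin.< v → u ~ v → (u , v) ∈ edges G
  ∈-edges⁺ u<v uv =
    ∈-filter⁺ (isEdge? G) (∈-cartesianProduct⁺ (∈-allFin _) (∈-allFin _)) (u<v , uv)

  ∈-edges⁻ : ∀ {u v} → (u , v) ∈ edges G → u Fin.< v × u ~ v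
  ∈-edges⁻ = proj₂ ∘ ∈-filter⁻ (isEdge? G) {xs = cartesianProduct (allFin n) (allFin n)}

  ∈ᵁ-edges : ∀ {u v} → u ~ v → (u , v) ∈ᵁ edges G
  ∈ᵁ-edges {u} {v} uv with Fin.<-cmp u v
  ... | tri< u<v _ _ = inj₁ (∈-edges⁺ u<v uv)
  ... | tri≈ _ refl _ = contradiction uv ~-irrefl
  ... | tri> _ _ v<u = inj₂ (∈-edges⁺ v<u (~-sym uv))

  -- `Y` may contain non-edges, repetitions and either orientation, so it is traded for the sublist
  -- `Z` of the edges of `G` in it. Removing `Z` destroys the same edges, and `Z` is no longer than
  -- `Y` because it is duplicate-free and lies in `Y` with every pair put in increasing order.
  τ-bound : ∀ {Y} → TriangleFree (G -ᴱ Y) → τ G ≤ length Y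
  τ-bound {Y} free = ℕ.≤-trans
    (All.lookup (Extrema.min≤xs (length (edges G)) _) (∈-map⁺ length Z∈)) Z≤Y
    where
    Z = filter (_∈ᵁ? Y) (edges G)
    orient : Edge n → Edge n
    orient (u , v) = if does (u Fin.<? v) then (u , v) else (v , u)
    orient-∈ : ∀ {u v} → u Fin.< v → (u , v) ∈ᵁ Y → (u , v) ∈ map orient Y
    orient-∈ {u} {v} u<v (inj₁ p) = subst (_∈ map orient Y) orient-id (∈-map⁺ orient p)
      where
      orient-id : orient (u , v) ≡ (u , v)
      orient-id = cong (if_then (u , v) else (v , u)) (dec-true (u Fin.<? v) u<v)
    orient-∈ {u} {v} u<v (inj₂ p) = subst (_∈ map orient Y) orient-swap (∈-map⁺ orient p)
      where
      orient-swap : orient (v , u) ≡ (u , v)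
      orient-swap = cong (if_then (v , u) else (u , v))
        (dec-false (v Fin.<? u) (Fin.<-asym u<v))
    Z⊆Y : Z ⊆ map orient Y
    Z⊆Y e∈Z with ∈-filter⁻ (_∈ᵁ? Y) {xs = edges G} e∈Z
    ... | e∈G , e∈Y = orient-∈ (proj₁ (∈-edges⁻ e∈G)) e∈Y
    Z≤Y : length Z ≤ length Y
    Z≤Y = ℕ.≤-trans
      (unique-⊆⇒length≤ (Unique.filter⁺ (_∈ᵁ? Y) edges-unique) Z⊆Y)
      (ℕ.≤-reflexive (length-map orient Y))
    kept : ∀ {u v} → SimpleGraph._~_ (G -ᴱ Z) u v → SimpleGraph._~_ (G -ᴱ Y) u v
    kept {u} {v} (uv , uv∉Z , vu∉Z) = uv , ∉Y ∘ inj₁ , ∉Y ∘ inj₂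
      where
      ∉Y : ¬ ((u , v) ∈ᵁ Y)
      ∉Y ∈Y with ∈ᵁ-edges uv
      ... | inj₁ ∈G = uv∉Z (∈-filter⁺ (_∈ᵁ? Y) ∈G ∈Y)
      ... | inj₂ ∈G = vu∉Z (∈-filter⁺ (_∈ᵁ? Y) ∈G (Sum.swap ∈Y))
    Z∈ : Z ∈ filter (λ Y → triangleFree? (G -ᴱ Y)) (sublists (edges G))
    Z∈ = ∈-filter⁺ (λ Y → triangleFree? (G -ᴱ Y)) (filter-∈-sublists (_∈ᵁ? Y) (edges G))
      λ (a , b , c , ab , bc , ac) → free (a , b , c , kept ab , kept bc , kept ac)

  tuzaPair⇒τ≤2ν : TuzaPair G → τ G ≤ 2 * ν G
  tuzaPair⇒τ≤2ν T = begin
    τ G                ≤⟨ τ-bound cover-covers ⟩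
    length cover       ≤⟨ cover-small ⟩
    2 * length packing ≤⟨ ℕ.*-monoʳ-≤ 2 (ν-bound packing-⊆ packing-disjoint) ⟩
    2 * ν G            ∎
    where
    open TuzaPair T
    open ℕ.≤-Reasoning

  tuzaPair-extend : (R : Reduction G) → TuzaPair (G -ᴱ Reduction.removed R) → TuzaPair G
  tuzaPair-extend R T = record
    { packing          = packing ++ family
    ; cover            = cover ++ hitting
    ; packing-⊆        = All.++⁺
        (All.map (λ (ab , bc , ac) → proj₁ ab , proj₁ bc , proj₁ ac) packing-⊆) family-⊆
    ; packing-disjoint = AllPairs.++⁺ packing-disjoint family-disjoint
        (All.map (λ p → All.map (apart p) family-removed) packing-⊆)
    -- `removed-hit` speaks of the first side only; the other two sides follow by reordering the
    -- vertices of the triangle.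
    ; cover-covers     = λ (a , b , c , ab , bc , ac) → cover-covers
        (a , b , c , kept ab bc ac ,
         kept bc (~-sym′ ac) (~-sym′ ab) , kept ac (~-sym′ bc) ab)
    ; cover-small      = begin
        length (cover ++ hitting)            ≡⟨ length-++ cover ⟩
        length cover + length hitting        ≤⟨ ℕ.+-mono-≤ cover-small hitting-small ⟩
        2 * length packing + 2 * length family ≡⟨ ℕ.*-distribˡ-+ 2 (length packing) _ ⟨
        2 * (length packing + length family) ≡⟨ cong (2 *_) (length-++ packing) ⟨
        2 * length (packing ++ family)       ∎
    }
    where
    open Reduction R
    open TuzaPair T
    open ℕ.≤-Reasoning
    ~-sym′ : ∀ {u v} → SimpleGraph._~_ (G -ᴱ (cover ++ hitting)) u v →
      SimpleGraph._~_ (G -ᴱ (cover ++ hitting)) v u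
    ~-sym′ = SimpleGraph.~-sym (G -ᴱ (cover ++ hitting))
    -- No side of `s` is in `removed`, while all sides of `t` are.
    apart : ∀ {s t} → IsTriangle (G -ᴱ removed) s →
      All (_∈ᵁ removed) (triangleEdges t) → SideDisjoint s t
    apart {s} {t} (ab , bc , ac) t∈ (e∈s , e∈t) =
      Sum.[ (λ p → All.lookup s∉ p e∈) , (λ p → All.lookup s∉ p (Sum.swap e∈)) ] (∈-sides⁻ s e∈s)
      where
      e∈ = ∈ᵁ-sides {t = t} t∈ e∈t
      s∉ : All (λ e → ¬ (e ∈ᵁ removed)) (triangleEdges s)
      s∉ = ~⇒∉ᵁ ab ∷ ~⇒∉ᵁ bc ∷ ~⇒∉ᵁ ac ∷ []
    kept : ∀ {a b c} → SimpleGraph._~_ (G -ᴱ (cover ++ hitting)) a b →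
      SimpleGraph._~_ (G -ᴱ (cover ++ hitting)) b c →
      SimpleGraph._~_ (G -ᴱ (cover ++ hitting)) a c →
      SimpleGraph._~_ ((G -ᴱ removed) -ᴱ cover) a b
    kept ab bc ac =
      (proj₁ ab , ab∉ ∘ inj₁ , ab∉ ∘ inj₂) , ∉cover ab ∘ inj₁ , ∉cover ab ∘ inj₂
      where
      ∉cover : ∀ {u v} → SimpleGraph._~_ (G -ᴱ (cover ++ hitting)) u v → ¬ ((u , v) ∈ᵁ cover)
      ∉cover uv = ~⇒∉ᵁ uv ∘ ∈ᵁ-mono ∈-++⁺ˡ
      ∉hitting : ∀ {u v} → SimpleGraph._~_ (G -ᴱ (cover ++ hitting)) u v → ¬ ((u , v) ∈ᵁ hitting)
      ∉hitting uv = ~⇒∉ᵁ uv ∘ ∈ᵁ-mono (∈-++⁺ʳ cover)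
      ab∉ = removed-hit (proj₁ ab , proj₁ bc , proj₁ ac) (∉hitting ab) (∉hitting bc) (∉hitting ac)

-- Refuting irreducible graphs in a finite chart

module _ (G : SimpleGraph n) where
  open SimpleGraph G

  -- The complement of the graph induced on the neighbourhood of v is a matching.
  CoMatching : Fin n → Set
  CoMatching v = ∀ {x y z} → v ~ x → v ~ y → v ~ z → x ≢ y → y ≢ z → x ≢ z →
    ¬ (y ~ x) → ¬ (y ~ z) → ⊥

-- A decision tree for graphs on Fin m: a leaf reduce S X K is a reduction with
-- family S, hitting set X and removed set X ++ K, and a leaf comatching v x y z
-- contradicts the hypothesis that v satisfies CoMatching.
data Tree (m : ℕ) : Set where
  reduce     : (S : List (Triangle m)) (X K : List (Edge m)) → Tree m
  comatching : (v x y z : Fin m) → Tree m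
  split      : Edge m → Tree m → Tree m → Tree m

module _ {m : ℕ} where

  -- `X` and `N` are appended because a side that is hit and a side known to be absent serve
  -- equally: no unhit triangle on i, j, k remains.
  Blocked : (X N : List (Edge m)) → Edge m → Fin m → Set
  Blocked X N (i , j) k =
    Any (_∈ᵁ X ++ N) ((i , j) ∷ (i , k) ∷ (j , k) ∷ []) ⊎ i ≡ k ⊎ j ≡ k

  Covers : (X K : List (Edge m)) → Triangle m → Set
  Covers X K t = All (_∈ᵁ X ++ K) (triangleEdges t)

  -- Whether the tree refutes every graph that contains the edges in P, avoids
  -- those in N, is CoMatching at B, and whose ambient graph has no vertex
  -- outside the chart adjacent to both ends of an edge in C.
  Refutes : (C : List (Edge m)) (B : List (Fin m)) (P N : List (Edge m)) → Tree m → Set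
  Refutes C B P N (reduce S X K) =
    All (λ t → All (_∈ᵁ P) (triangleEdges t)) S ×
    AllPairs SideDisjoint S ×
    All (Covers X K) S ×
    length X ≤ 2 * length S ×
    All (_∈ᵁ C) K ×
    Any (_∈ᵁ P) K ×
    All (λ e → ∀ k → Blocked X N e k) K
  Refutes C B P N (comatching v x y z) =
    v ∈ B × All (_∈ᵁ P) ((v , x) ∷ (v , y) ∷ (v , z) ∷ []) ×
    x ≢ y × y ≢ z × x ≢ z × (y , x) ∈ᵁ N × (y , z) ∈ᵁ N
  Refutes C B P N (split e t f) = Refutes C B (e ∷ P) N t × Refutes C B P (e ∷ N) f

  refutes? : ∀ C B P N t → Dec (Refutes C B P N t)
  refutes? C B P N (reduce S X K) =
    All.all? (λ t → All.all? (_∈ᵁ? P) (triangleEdges t)) S ×-dec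
    AllPairs.allPairs? (λ s t → disjoint? (sides s) (sides t)) S ×-dec
    All.all? (λ t → All.all? (_∈ᵁ? (X ++ K)) (triangleEdges t)) S ×-dec
    length X ℕ.≤? 2 * length S ×-dec
    All.all? (_∈ᵁ? C) K ×-dec
    Any.any? (_∈ᵁ? P) K ×-dec
    All.all? (λ (i , j) → Fin.all? λ k →
      Any.any? (_∈ᵁ? (X ++ N)) _ ⊎-dec
      i Fin.≟ k ⊎-dec j Fin.≟ k) K
    where open DecDisjoint _≟ᴱ_ using (disjoint?)
  refutes? C B P N (comatching v x y z) =
    v DecFin.∈? B ×-dec All.all? (_∈ᵁ? P) _ ×-dec
    ¬? (x Fin.≟ y) ×-dec ¬? (y Fin.≟ z) ×-dec ¬? (x Fin.≟ z) ×-dec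
    (y , x) ∈ᵁ? N ×-dec (y , z) ∈ᵁ? N
    where module DecFin = DecMembership Fin._≟_
  refutes? C B P N (split e t f) = refutes? C B (e ∷ P) N t ×-dec refutes? C B P (e ∷ N) f

module Chart {G : SimpleGraph n} (irreducible : ¬ Reduction G)
  {m : ℕ} (ρ : Fin m → Fin n) (ρ-injective : ∀ {i j} → ρ i ≡ ρ j → i ≡ j)
  where
  open SimpleGraph G

  private
    ρᴱ : Edge m → Edge n
    ρᴱ (i , j) = ρ i , ρ j

    ρᵀ : Triangle m → Triangle n
    ρᵀ (i , j , k) = ρ i , ρ j , ρ k

    ρᴱ-injective : ∀ {d e} → ρᴱ d ≡ ρᴱ e → d ≡ e
    ρᴱ-injective eq = cong₂ _,_ (ρ-injective (cong proj₁ eq)) (ρ-injective (cong proj₂ eq))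

    ∈ᵁ-map⁺ : ∀ {e X} → e ∈ᵁ X → ρᴱ e ∈ᵁ map ρᴱ X
    ∈ᵁ-map⁺ = Sum.map (∈-map⁺ ρᴱ) (∈-map⁺ ρᴱ)

    disjoint-map : ∀ {s t} → SideDisjoint s t → SideDisjoint (ρᵀ s) (ρᵀ t)
    disjoint-map {s} {t} dis (p , q)
      with ∈-map⁻ ρᴱ {xs = sides s} p | ∈-map⁻ ρᴱ {xs = sides t} q
    ... | d , d∈s , refl | e , e∈t , eq with refl ← ρᴱ-injective eq = dis (d∈s , e∈t)

  Adjacent NonAdjacent : Edge m → Set
  Adjacent (i , j) = ρ i ~ ρ j
  NonAdjacent e = ¬ Adjacent e

  Closed : Edge m → Set
  Closed (i , j) = ∀ {w} → ρ i ~ w → ρ j ~ w → ∃ λ k → w ≡ ρ k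

  module _ {C : List (Edge m)} {B : List (Fin m)}
    (closed : All Closed C) (co : All (CoMatching G ∘ ρ) B) where

    private
      adjacent : ∀ {P} → All Adjacent P → ∀ {i j} → (i , j) ∈ᵁ P → ρ i ~ ρ j
      adjacent ps = Sum.[ All.lookup ps , ~-sym ∘ All.lookup ps ]

      nonAdjacent : ∀ {N} → All NonAdjacent N → ∀ {i j} → (i , j) ∈ᵁ N → ¬ (ρ i ~ ρ j)
      nonAdjacent ns = Sum.[ All.lookup ns , (λ p → All.lookup ns p ∘ ~-sym) ]

      missed : ∀ {X N i j} → All NonAdjacent N → (i , j) ∈ᵁ X ++ N → ρ i ~ ρ j →
        ¬ ((ρ i , ρ j) ∈ᵁ map ρᴱ X) → ⊥
      missed {X} ns p ij ∉X = Sum.[ ∉X ∘ ∈ᵁ-map⁺ , (λ q → nonAdjacent ns q ij) ] (∈ᵁ-++⁻ X p)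

      blocked-sound : ∀ {X N i j k} → All NonAdjacent N → Blocked X N (i , j) k →
        ρ i ~ ρ j → ρ i ~ ρ k → ρ j ~ ρ k → ¬ ((ρ i , ρ j) ∈ᵁ map ρᴱ X) →
        ¬ ((ρ i , ρ k) ∈ᵁ map ρᴱ X) → ¬ ((ρ j , ρ k) ∈ᵁ map ρᴱ X) → ⊥
      blocked-sound ns b ij ik jk ∉ij ∉ik ∉jk = case b of λ where
        (inj₁ (here p))                 → missed ns p ij ∉ij
        (inj₁ (there (here p)))         → missed ns p ik ∉ik
        (inj₁ (there (there (here p)))) → missed ns p jk ∉jk
        (inj₂ (inj₁ refl))              → ~-irrefl ik
        (inj₂ (inj₂ refl))              → ~-irrefl jk

    -- Induction on the tree. At a leaf `reduce S X K`, an unhit triangle with a side in `X ++ K`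
    -- has that side in `K`; closedness puts its third vertex into the chart, where it is blocked.
    refute : ∀ {P N} t → Refutes C B P N t → All Adjacent P → All NonAdjacent N → ⊥
    refute {P} {N} (reduce S X K) (S⊆P , dis , S⊆F , X≤S , K⊆C , K∩P , blocked) ps ns =
      irreducible record
        { family          = map ρᵀ S
        ; hitting         = map ρᴱ X
        ; removed         = map ρᴱ (X ++ K)
        ; family-⊆        = All.map⁺ (All.map
            (λ { (p ∷ q ∷ r ∷ []) → adjacent ps p , adjacent ps q , adjacent ps r }) S⊆P)
        ; family-disjoint = AllPairs.map⁺ (AllPairs.map (λ {s} {t} → disjoint-map {s} {t}) dis)
        ; family-removed  = All.map⁺ (All.map (λ es → All.map⁺ (All.map ∈ᵁ-map⁺ es)) S⊆F)
        ; hitting-small   = subst (λ x → x ≤ 2 * length (map ρᵀ S)) (sym (length-map ρᴱ X))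
            (subst (λ y → length X ≤ 2 * y) (sym (length-map ρᵀ S)) X≤S)
        ; removed-hit     = hit
        ; removed-edge    = edge
        }
      where
      edge : ∃ λ e → e ∈ map ρᴱ (X ++ K) × uncurry _~_ e
      edge with _ , e∈K , e∈P ← find K∩P =
        _ , ∈-map⁺ ρᴱ (∈-++⁺ʳ X e∈K) , adjacent ps e∈P
      inside : ∀ {i j c} → (i , j) ∈ K → ρ i ~ ρ j → ρ i ~ c → ρ j ~ c →
        ¬ ((ρ i , ρ j) ∈ᵁ map ρᴱ X) →
        ¬ ((ρ i , c) ∈ᵁ map ρᴱ X) → ¬ ((ρ j , c) ∈ᵁ map ρᴱ X) → ⊥
      inside e∈K ij ic jc ∉ij with closed-at (All.lookup K⊆C e∈K) ic jc
        where
        closed-at : ∀ {i j} → (i , j) ∈ᵁ C → Closed (i , j)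
        closed-at (inj₁ p) = All.lookup closed p
        closed-at (inj₂ p) ic jc = All.lookup closed p jc ic
      ... | k , refl = blocked-sound ns (All.lookup blocked e∈K k) ij ic jc ∉ij
      hit : ∀ {a b c} → a ~ b × b ~ c × a ~ c → ¬ ((a , b) ∈ᵁ map ρᴱ X) →
        ¬ ((b , c) ∈ᵁ map ρᴱ X) → ¬ ((a , c) ∈ᵁ map ρᴱ X) → ¬ ((a , b) ∈ᵁ map ρᴱ (X ++ K))
      hit (ab , bc , ac) ∉ab ∉bc ∉ac (inj₁ p) with ∈-map⁻ ρᴱ p
      ... | e , e∈F , refl with ∈-++⁻ X e∈F
      ...   | inj₁ e∈X = ∉ab (inj₁ (∈-map⁺ ρᴱ e∈X))
      ...   | inj₂ e∈K = inside e∈K ab ac bc ∉ab ∉ac ∉bc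
      hit (ab , bc , ac) ∉ab ∉bc ∉ac (inj₂ p) with ∈-map⁻ ρᴱ p
      ... | e , e∈F , refl with ∈-++⁻ X e∈F
      ...   | inj₁ e∈X = ∉ab (inj₂ (∈-map⁺ ρᴱ e∈X))
      ...   | inj₂ e∈K = inside e∈K (~-sym ab) bc ac (∉ab ∘ Sum.swap) ∉bc ∉ac
    refute (comatching v x y z) (v∈B , vx ∷ vy ∷ vz ∷ [] , x≢y , y≢z , x≢z , yx , yz) ps ns =
      All.lookup co v∈B (adjacent ps vx) (adjacent ps vy) (adjacent ps vz)
        (x≢y ∘ ρ-injective) (y≢z ∘ ρ-injective) (x≢z ∘ ρ-injective)
        (nonAdjacent ns yx) (nonAdjacent ns yz)
    refute (split (i , j) t f) (t-ok , f-ok) ps ns with ρ i ~? ρ j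
    ... | yes ij = refute t t-ok (ij ∷ ps) ns
    ... | no ¬ij = refute f f-ok ps (¬ij ∷ ns)

-- In a chart of the neighbourhood of the vertex 0F, a matching and a vertex
-- cover of the remaining edges of equal size are a reduction: the matching and
-- the edges from 0F to the cover hit every triangle through 0F, and the family
-- consists of the triangles spanned by 0F and the edges of the matching.
spokes : ∀ {m} → List (Edge (suc m))
spokes {m} = map (λ i → 0F , Fin.suc i) (allFin m)

star : ∀ {m} → List (Edge (suc m)) → List (Fin (suc m)) → Tree (suc m)
star matching vertices = reduce
  (map (0F ,_) matching)
  (matching ++ map (0F ,_) vertices)
  (map (λ e → 0F , proj₁ e) matching ++ map (λ e → 0F , proj₂ e) matching)

-- An edge in no triangle can be removed with empty family and empty hitting set.
isolated : ∀ {m} → Fin (suc m) → Tree (suc m)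
isolated i = reduce [] [] ((0F , i) ∷ [])

star₁ : ∀ {m} (a b x : Fin (suc m)) → Tree (suc m)
star₁ a b x = star ((a , b) ∷ []) (x ∷ [])

star₂ : ∀ {m} (a b c d x y : Fin (suc m)) → Tree (suc m)
star₂ a b c d x y = star ((a , b) ∷ (c , d) ∷ []) (x ∷ y ∷ [])

star₃ : ∀ {m} (a b c d e f x y z : Fin (suc m)) → Tree (suc m)
star₃ a b c d e f x y z = star ((a , b) ∷ (c , d) ∷ (e , f) ∷ []) (x ∷ y ∷ z ∷ [])

-- The trees were found by a computer search.  fiveTree and sixTree assume that
-- 1F is adjacent to neither 2F nor 3F.
twoTree : Tree 3
twoTree =
  split (1F , 2F) (star₁ 1F 2F 1F) (isolated 1F)

threeTree : Tree 4
threeTree =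
  split (2F , 3F) (star₁ 2F 3F 1F) (split (1F , 3F) (star₁ 1F 3F 1F) (isolated 3F))

fourTree : Tree 5
fourTree =
  split (3F , 4F)
    (split (1F , 2F)
       (star₂ 1F 2F 3F 4F 1F 2F)
       (split (2F , 4F)
          (split (1F , 3F)
             (star₂ 1F 3F 2F 4F 1F 3F)
             (split (2F , 3F) (star₁ 2F 3F 4F) (star₁ 3F 4F 4F)))
          (split (1F , 4F) (star₁ 1F 4F 3F) (star₁ 3F 4F 3F))))
    (split (2F , 4F)
       (split (1F , 3F)
          (star₂ 1F 3F 2F 4F 1F 2F)
          (split (1F , 4F) (star₁ 1F 4F 2F) (star₁ 2F 4F 2F)))
       (split (2F , 3F)
          (star₁ 2F 3F 1F)
          (split (1F , 4F) (star₁ 1F 4F 1F) (isolated 4F))))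

fiveTree : Tree 6
fiveTree =
  split (1F , 5F)
    (split (2F , 3F)
       (star₂ 1F 5F 2F 3F 4F 5F)
       (split (3F , 4F)
          (star₂ 1F 5F 3F 4F 4F 5F)
          (split (2F , 4F)
             (star₂ 1F 5F 2F 4F 1F 5F)
             (split (1F , 4F) (star₁ 1F 4F 5F) (star₁ 1F 5F 5F)))))
    (split (1F , 4F)
       (split (3F , 5F)
          (star₂ 1F 4F 3F 5F 2F 4F)
          (split (2F , 5F)
             (star₂ 1F 4F 2F 5F 2F 4F)
             (split (2F , 3F) (star₂ 1F 4F 2F 3F 1F 4F) (star₁ 1F 4F 4F))))
       (isolated 1F))

sixTree : Tree 7
sixTree =
  split (1F , 6F)
    (split (2F , 3F)
       (split (4F , 5F)
          (star₃ 1F 6F 2F 3F 4F 5F 4F 5F 6F)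
          (split (1F , 5F)
             (split (4F , 6F)
                (star₃ 1F 5F 2F 3F 4F 6F 4F 5F 6F)
                (split (3F , 4F)
                   (split (2F , 6F)
                      (split (1F , 4F)
                         (split (5F , 6F)
                            (star₃ 1F 4F 2F 3F 5F 6F 1F 2F 3F)
                            (star₃ 1F 5F 2F 6F 3F 4F 1F 2F 3F))
                         (star₃ 1F 5F 2F 6F 3F 4F 2F 3F 6F))
                      (split (2F , 5F)
                         (star₃ 1F 6F 2F 5F 3F 4F 3F 4F 5F)
                         (split (2F , 4F)
                            (split (3F , 6F)
                               (star₃ 1F 5F 2F 4F 3F 6F 1F 3F 5F)
                               (star₂ 1F 6F 2F 3F 4F 5F))
                            (split (5F , 6F)
                               (star₂ 2F 3F 5F 6F 1F 3F)
                               (star₂ 1F 5F 2F 3F 1F 3F)))))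
                   (split (2F , 4F)
                      (split (3F , 6F)
                         (star₃ 1F 5F 2F 4F 3F 6F 1F 2F 5F)
                         (split (3F , 5F)
                            (star₃ 1F 6F 2F 4F 3F 5F 1F 2F 5F)
                            (split (5F , 6F)
                               (star₂ 2F 3F 5F 6F 1F 2F)
                               (star₂ 1F 6F 2F 4F 1F 2F))))
                      (split (1F , 4F)
                         (star₂ 1F 4F 2F 3F 5F 6F)
                         (star₂ 1F 5F 2F 3F 5F 6F)))))
             (split (3F , 5F)
                (split (2F , 4F)
                   (star₃ 1F 6F 2F 4F 3F 5F 2F 4F 6F)
                   (split (1F , 4F)
                      (split (2F , 5F)
                         (star₂ 1F 4F 2F 5F 3F 6F)
                         (star₂ 1F 4F 2F 3F 3F 6F))
                      (split (2F , 5F)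
                         (star₂ 1F 6F 2F 5F 3F 6F)
                         (star₂ 1F 6F 2F 3F 3F 6F))))
                (split (2F , 5F)
                   (split (3F , 4F)
                      (star₃ 1F 6F 2F 5F 3F 4F 1F 2F 6F)
                      (split (1F , 4F)
                         (star₂ 1F 4F 2F 3F 2F 6F)
                         (star₂ 1F 6F 2F 5F 2F 6F)))
                   (star₂ 1F 6F 2F 3F 4F 6F)))))
       (split (3F , 5F)
          (split (2F , 4F)
             (star₃ 1F 6F 2F 4F 3F 5F 4F 5F 6F)
             (split (3F , 4F)
                (split (2F , 5F)
                   (star₃ 1F 6F 2F 5F 3F 4F 1F 5F 6F)
                   (split (2F , 6F)
                      (split (1F , 5F)
                         (star₃ 1F 5F 2F 6F 3F 4F 1F 5F 6F)
                         (star₂ 2F 6F 3F 5F 4F 6F))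
                      (isolated 2F)))
                (split (1F , 4F) (star₂ 1F 4F 3F 5F 5F 6F) (star₂ 1F 6F 3F 5F 5F 6F))))
          (split (3F , 4F)
             (split (2F , 5F)
                (star₃ 1F 6F 2F 5F 3F 4F 1F 4F 6F)
                (split (1F , 5F) (star₂ 1F 5F 3F 4F 4F 6F) (star₂ 1F 6F 3F 4F 4F 6F)))
             (split (3F , 6F)
                (split (2F , 5F)
                   (split (1F , 4F)
                      (star₃ 1F 4F 2F 5F 3F 6F 1F 4F 6F)
                      (split (2F , 4F)
                         (star₂ 1F 6F 2F 4F 5F 6F)
                         (star₂ 1F 6F 2F 5F 5F 6F)))
                   (split (1F , 5F)
                      (star₂ 1F 5F 3F 6F 4F 6F)
                      (split (4F , 5F)
                         (star₂ 3F 6F 4F 5F 4F 6F)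
                         (split (2F , 4F)
                            (star₂ 1F 6F 2F 4F 1F 6F)
                            (split (1F , 4F) (star₁ 1F 4F 6F) (star₁ 1F 6F 6F))))))
                (isolated 3F)))))
    (split (1F , 5F)
       (split (3F , 6F)
          (split (2F , 4F)
             (star₃ 1F 5F 2F 4F 3F 6F 2F 4F 5F)
             (split (2F , 6F)
                (split (3F , 4F)
                   (star₃ 1F 5F 2F 6F 3F 4F 3F 4F 5F)
                   (split (1F , 4F)
                      (split (2F , 3F)
                         (star₂ 1F 4F 2F 3F 5F 6F)
                         (star₂ 1F 4F 3F 6F 5F 6F))
                      (split (2F , 3F)
                         (star₂ 1F 5F 2F 3F 5F 6F)
                         (star₂ 1F 5F 3F 6F 5F 6F))))
                (split (2F , 3F)
                   (split (4F , 6F)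
                      (star₃ 1F 5F 2F 3F 4F 6F 1F 3F 5F)
                      (split (1F , 4F)
                         (star₂ 1F 4F 2F 3F 3F 5F)
                         (star₂ 1F 5F 2F 3F 3F 5F)))
                   (star₂ 1F 5F 3F 6F 4F 5F))))
          (split (2F , 6F)
             (split (3F , 4F)
                (star₃ 1F 5F 2F 6F 3F 4F 2F 4F 5F)
                (split (2F , 3F)
                   (split (4F , 6F)
                      (star₃ 1F 5F 2F 3F 4F 6F 1F 2F 5F)
                      (split (1F , 4F)
                         (star₂ 1F 4F 2F 3F 2F 5F)
                         (star₂ 1F 5F 2F 3F 2F 5F)))
                   (star₂ 1F 5F 2F 6F 4F 5F)))
             (split (2F , 3F)
                (star₂ 1F 5F 2F 3F 4F 5F)
                (split (4F , 6F)
                   (star₂ 1F 5F 4F 6F 4F 5F)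
                   (split (3F , 4F)
                      (star₂ 1F 5F 3F 4F 4F 5F)
                      (split (2F , 4F)
                         (star₂ 1F 5F 2F 4F 1F 5F)
                         (split (1F , 4F) (star₁ 1F 4F 5F) (star₁ 1F 5F 5F))))))))
       (split (1F , 4F)
          (split (5F , 6F)
             (split (2F , 3F)
                (star₃ 1F 4F 2F 3F 5F 6F 2F 3F 4F)
                (split (3F , 6F)
                   (split (2F , 5F)
                      (star₃ 1F 4F 2F 5F 3F 6F 2F 4F 5F)
                      (split (3F , 5F)
                         (star₂ 1F 4F 3F 5F 4F 6F)
                         (star₂ 1F 4F 3F 6F 4F 6F)))
                   (split (2F , 6F) (star₂ 1F 4F 2F 6F 4F 5F) (star₂ 1F 4F 5F 6F 4F 5F))))
             (split (3F , 6F)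
                (split (2F , 5F)
                   (star₃ 1F 4F 2F 5F 3F 6F 2F 3F 4F)
                   (split (2F , 6F) (star₂ 1F 4F 2F 6F 3F 4F) (star₂ 1F 4F 3F 6F 3F 4F)))
                (split (3F , 5F)
                   (star₂ 1F 4F 3F 5F 2F 4F)
                   (split (2F , 6F)
                      (star₂ 1F 4F 2F 6F 2F 4F)
                      (split (2F , 5F)
                         (star₂ 1F 4F 2F 5F 2F 4F)
                         (split (2F , 3F) (star₂ 1F 4F 2F 3F 1F 4F) (star₁ 1F 4F 4F)))))))
          (isolated 1F)))

-- `spokes` occurs twice: the spokes are edges, and they are closed because the chart contains all
-- neighbours of the centre.
StarRefutes : ∀ {m} → List (Edge (suc m)) → Tree (suc m) → Set
StarRefutes = Refutes spokes [] spokes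

pathNonEdges : ∀ {m} → List (Edge (4 + m))
pathNonEdges = (1F , 2F) ∷ (1F , 3F) ∷ []

oneTree-refutes : StarRefutes [] (isolated {1} 1F)
oneTree-refutes = toWitness {a? = refutes? spokes [] spokes [] (isolated {1} 1F)} _

twoTree-refutes : StarRefutes [] twoTree
twoTree-refutes = toWitness {a? = refutes? spokes [] spokes [] twoTree} _

threeTree-refutes : StarRefutes [] threeTree
threeTree-refutes = toWitness {a? = refutes? spokes [] spokes [] threeTree} _

fourTree-refutes : StarRefutes [] fourTree
fourTree-refutes = toWitness {a? = refutes? spokes [] spokes [] fourTree} _

fiveTree-refutes : StarRefutes pathNonEdges fiveTree
fiveTree-refutes = toWitness {a? = refutes? spokes [] spokes pathNonEdges fiveTree} _

sixTree-refutes : StarRefutes pathNonEdges sixTree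
sixTree-refutes = toWitness {a? = refutes? spokes [] spokes pathNonEdges sixTree} _

-- Charts of two adjacent vertices 0F and 1F and their neighbours: the trees
-- remove every edge at 0F or 1F.
ends : ∀ {m} → List (Edge (2 + m))
ends {m} = spokes ++ map (λ i → 1F , Fin.suc (Fin.suc i)) (allFin m)

module _ {m : ℕ} where

  -- The leaf receives the edges ab, bd, dc and ca: four common neighbours of 0F
  -- and 1F span a 4-cycle since their non-adjacent pairs are disjoint.
  fourCycle : (leaf : (a b c d : Fin (2 + m)) → Tree (2 + m)) →
    (a b c d : Fin (2 + m)) → Tree (2 + m)
  fourCycle leaf a b c d =
    split (c , d)
      (split (a , b)
        (split (b , d)
          (split (a , c)
            (leaf a c b d)
            (split (b , c)
              (split (a , d)
                (leaf a b d c)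
                (comatching 0F c a d))
              (comatching 0F a c b)))
          (split (b , c)
            (split (a , d)
              (leaf a b d c)
              (comatching 0F a d b))
            (comatching 0F c b d)))
        (split (b , d)
          (split (a , c)
            (split (b , c)
              (split (a , d)
                (leaf a c d b)
                (comatching 0F b a d))
              (comatching 0F a b c))
            (comatching 0F b a c))
          (comatching 0F a b d)))
      (split (b , d)
        (split (a , c)
          (split (b , c)
            (split (a , d)
              (leaf a c d b)
              (comatching 0F a d c))
            (comatching 0F b c d))
          (comatching 0F a c d))
        (comatching 0F b d c))

  -- Each end takes one pair of opposite edges of the 4-cycle. The edge between the ends and the six
  -- pairs among a, b, c, d hit all triangles at the ends, except those through a fifth neighbour of
  -- one end. Four triangles allow eight edges, so `X` has room for one edge to such a neighbour.
  quadruple : List (Edge (2 + m)) → (a b c d : Fin (2 + m)) → Tree (2 + m)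
  quadruple X a b c d = reduce
    ((0F , a , b) ∷ (0F , c , d) ∷ (1F , a , c) ∷ (1F , b , d) ∷ [])
    ((0F , 1F) ∷ (a , b) ∷ (a , c) ∷ (a , d) ∷ (b , c) ∷ (b , d) ∷ (c , d) ∷ X)
    ends

  -- The triangle on both ends and the fifth common neighbour e pays for cutting e off from both
  -- ends: nine edges against five triangles.
  quintuple : (e a b c d : Fin (2 + m)) → Tree (2 + m)
  quintuple e a b c d = reduce
    ((0F , 1F , e) ∷ (0F , a , b) ∷ (0F , c , d) ∷ (1F , a , c) ∷ (1F , b , d) ∷ [])
    ((a , b) ∷ (c , d) ∷ (a , c) ∷ (b , d) ∷ (a , d) ∷ (b , c) ∷
     (0F , 1F) ∷ (0F , e) ∷ (1F , e) ∷ [])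
    ends

  -- The private neighbour x of 0F is not adjacent to 1F, so `CoMatching` makes it adjacent to b;
  -- likewise y to c. The hitting set cuts x, y and d off from the ends, and the three pairs among
  -- a, b, c and the edge between the ends take care of the other triangles; xb and yc are listed so
  -- that `removed` contains all sides of the family.
  quadruple⁺ : (x y a b c d : Fin (2 + m)) → Tree (2 + m)
  quadruple⁺ x y a b c d =
    split (x , b)
      (split (y , c)
        (reduce
          ((0F , x , b) ∷ (0F , a , c) ∷ (0F , 1F , d) ∷ (1F , y , c) ∷ (1F , a , b) ∷ [])
          ((x , b) ∷ (a , c) ∷ (y , c) ∷ (a , b) ∷ (b , c) ∷
           (0F , 1F) ∷ (0F , x) ∷ (1F , y) ∷ (0F , d) ∷ (1F , d) ∷ [])
          ends)
        (comatching 1F 0F y c))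
      (comatching 0F 1F x b)

-- Here c is adjacent to a and b, and the private neighbours 5F of 0F and 6F of 1F are adjacent to a
-- and b respectively.
triple : (a b c : Fin 7) → Tree 7
triple a b c = reduce
  ((0F , 5F , a) ∷ (0F , b , c) ∷ (1F , 6F , b) ∷ (1F , a , c) ∷ [])
  ((5F , a) ∷ (b , c) ∷ (6F , b) ∷ (a , c) ∷ (a , b) ∷ (0F , 1F) ∷ (0F , 5F) ∷ (1F , 6F) ∷ [])
  ends

-- By `CoMatching` at most one pair among the three common neighbours is non-adjacent, so one of
-- them is adjacent to the other two and serves as c. A private neighbour misses the other end,
-- hence is adjacent to all common neighbours.
tripleTree : Tree 7
tripleTree =
  split (3F , 4F)
    (split (6F , 2F)
      (split (5F , 4F)
        (split (2F , 3F)
          (triple 4F 2F 3F)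
          (split (2F , 4F)
            (split (5F , 3F)
              (triple 3F 2F 4F)
              (comatching 0F 1F 5F 3F))
            (comatching 0F 3F 2F 4F)))
        (comatching 0F 1F 5F 4F))
      (comatching 1F 0F 6F 2F))
    (split (2F , 4F)
      (split (2F , 3F)
        (split (6F , 4F)
          (split (5F , 3F)
            (triple 3F 4F 2F)
            (comatching 0F 5F 3F 4F))
          (comatching 1F 0F 6F 4F))
        (comatching 0F 2F 3F 4F))
      (comatching 0F 2F 4F 3F))

-- The neighbours of 0F and 1F other than these two are those in shared, those
-- of 0F alone in only₀ and those of 1F alone in only₁.
record PairCertificate (m : ℕ) : Set where
  field
    shared only₀ only₁ : List (Fin (2 + m))

  pairEdges : List (Edge (2 + m))
  pairEdges = (0F , 1F) ∷
    map (0F ,_) shared ++ map (1F ,_) shared ++ map (0F ,_) only₀ ++ map (1F ,_) only₁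

  pairNonEdges : List (Edge (2 + m))
  pairNonEdges = map (1F ,_) only₀ ++ map (0F ,_) only₁

  field
    tree    : Tree (2 + m)
    refutes : Refutes ends (0F ∷ 1F ∷ []) pairEdges pairNonEdges tree

certify : ∀ {m} (shared only₀ only₁ : List (Fin (2 + m))) (tree : Tree (2 + m)) →
  {True (refutes? ends (0F ∷ 1F ∷ [])
    ((0F , 1F) ∷ map (0F ,_) shared ++ map (1F ,_) shared ++
      map (0F ,_) only₀ ++ map (1F ,_) only₁)
    (map (1F ,_) only₀ ++ map (0F ,_) only₁) tree)} →
  PairCertificate m
certify shared only₀ only₁ tree {ok} = record
  { shared  = shared
  ; only₀   = only₀
  ; only₁   = only₁
  ; tree    = tree
  ; refutes = toWitness ok
  }

four-common : PairCertificate 4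
four-common = certify (2F ∷ 3F ∷ 4F ∷ 5F ∷ []) [] [] (fourCycle (quadruple []) 2F 3F 4F 5F)

five-common : PairCertificate 5
five-common = certify (2F ∷ 3F ∷ 4F ∷ 5F ∷ 6F ∷ []) [] [] (fourCycle (quintuple 6F) 2F 3F 4F 5F)

fourˡ-common : PairCertificate 5
fourˡ-common = certify (2F ∷ 3F ∷ 4F ∷ 5F ∷ []) (6F ∷ []) []
  (fourCycle (quadruple ((0F , 6F) ∷ [])) 2F 3F 4F 5F)

fourʳ-common : PairCertificate 5
fourʳ-common = certify (2F ∷ 3F ∷ 4F ∷ 5F ∷ []) [] (6F ∷ [])
  (fourCycle (quadruple ((1F , 6F) ∷ [])) 2F 3F 4F 5F)

fourˡʳ-common : PairCertificate 6
fourˡʳ-common = certify (2F ∷ 3F ∷ 4F ∷ 5F ∷ []) (6F ∷ []) (7F ∷ [])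
  (fourCycle (quadruple⁺ 6F 7F) 2F 3F 4F 5F)

threeˡʳ-common : PairCertificate 5
threeˡʳ-common = certify (2F ∷ 3F ∷ 4F ∷ []) (5F ∷ []) (6F ∷ []) tripleTree

-- 0F has the high neighbours 1F, 2F, 3F and independent low neighbours 4F, 5F, 6F. A triangle on 0F
-- and one of these low vertices has a high third vertex, so the three edges from 0F to high
-- vertices hit it.
lowTree : Tree 7
lowTree = reduce
  ((0F , 1F , 4F) ∷ (0F , 2F , 5F) ∷ (0F , 3F , 6F) ∷ [])
  ((1F , 4F) ∷ (2F , 5F) ∷ (3F , 6F) ∷ (0F , 1F) ∷ (0F , 2F) ∷ (0F , 3F) ∷ [])
  ((0F , 4F) ∷ (0F , 5F) ∷ (0F , 6F) ∷ [])

lowTree-refutes : Refutes ((0F , 4F) ∷ (0F , 5F) ∷ (0F , 6F) ∷ []) []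
  (spokes ++ (1F , 4F) ∷ (2F , 5F) ∷ (3F , 6F) ∷ [])
  ((4F , 5F) ∷ (4F , 6F) ∷ (5F , 6F) ∷ []) lowTree
lowTree-refutes = toWitness {a? = refutes? ((0F , 4F) ∷ (0F , 5F) ∷ (0F , 6F) ∷ []) []
  (spokes ++ (1F , 4F) ∷ (2F , 5F) ∷ (3F , 6F) ∷ [])
  ((4F , 5F) ∷ (4F , 6F) ∷ (5F , 6F) ∷ []) lowTree} _

-- Vertices of an irreducible graph

module Neighbourhood (G : SimpleGraph n) where
  open SimpleGraph G

  nbrs : Fin n → List (Fin n)
  nbrs v = filter (v ~?_) (allFin n)

  deg : Fin n → ℕ
  deg v = length (nbrs v)

  common : Fin n → Fin n → List (Fin n)
  common u v = filter (v ~?_) (nbrs u)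

  exclusive? : ∀ v w → Dec (¬ (v ~ w) × w ≢ v)
  exclusive? v w = ¬? (v ~? w) ×-dec ¬? (w Fin.≟ v)

  exclusive : Fin n → Fin n → List (Fin n)
  exclusive u v = filter (exclusive? v) (nbrs u)

  ∈-nbrs⁺ : ∀ {v w} → v ~ w → w ∈ nbrs v
  ∈-nbrs⁺ {v} vw = ∈-filter⁺ (v ~?_) (∈-allFin _) vw

  ∈-nbrs⁻ : ∀ {v w} → w ∈ nbrs v → v ~ w
  ∈-nbrs⁻ {v} = proj₂ ∘ ∈-filter⁻ (v ~?_) {xs = allFin n}

  nbrs-unique : ∀ v → Unique (nbrs v)
  nbrs-unique v = Unique.filter⁺ (v ~?_) (Unique.allFin⁺ n)

  ~⇒≢ : ∀ {u v} → u ~ v → u ≢ v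
  ~⇒≢ uv refl = ~-irrefl uv

  ∈-common⁺ : ∀ {u v w} → u ~ w → v ~ w → w ∈ common u v
  ∈-common⁺ {v = v} uw vw = ∈-filter⁺ (v ~?_) (∈-nbrs⁺ uw) vw

  ∈-common⁻ : ∀ {u v w} → w ∈ common u v → u ~ w × v ~ w
  ∈-common⁻ {u} {v} w∈ = let p , q = ∈-filter⁻ (v ~?_) {xs = nbrs u} w∈ in ∈-nbrs⁻ p , q

  common-unique : ∀ u v → Unique (common u v)
  common-unique u v = Unique.filter⁺ (v ~?_) (nbrs-unique u)

  ∈-exclusive⁻ : ∀ {u v w} → w ∈ exclusive u v → u ~ w × ¬ (v ~ w) × w ≢ v
  ∈-exclusive⁻ {u} {v} w∈ =
    let p , q = ∈-filter⁻ (exclusive? v) {xs = nbrs u} w∈ in ∈-nbrs⁻ p , q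

  exclusive-unique : ∀ u v → Unique (exclusive u v)
  exclusive-unique u v = Unique.filter⁺ (exclusive? v) (nbrs-unique u)

  nbrs⊆ : ∀ {u v w} → u ~ w → w ∈ v ∷ common u v ++ exclusive u v
  nbrs⊆ {u} {v} {w} uw with w Fin.≟ v | v ~? w
  ... | yes refl | _      = here refl
  ... | no _     | yes vw = there (∈-++⁺ˡ (∈-common⁺ uw vw))
  ... | no w≢v   | no ¬vw = there (∈-++⁺ʳ (common u v)
    (∈-filter⁺ (exclusive? v) (∈-nbrs⁺ uw) (¬vw , w≢v)))

  deg-split : ∀ {u v} → u ~ v →
    deg u ≡ suc (length (common u v) + length (exclusive u v))
  deg-split {u} {v} uv = trans
    (unique-⊆-⊇⇒length≡ (nbrs-unique u) unique (nbrs⊆ ∘ ∈-nbrs⁻) ⊆nbrs)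
    (cong suc (length-++ (common u v)))
    where
    unique : Unique (v ∷ common u v ++ exclusive u v)
    unique = All.++⁺ (All.tabulate λ w∈ → ~⇒≢ (proj₂ (∈-common⁻ w∈)))
        (All.tabulate λ w∈ → proj₂ (proj₂ (∈-exclusive⁻ w∈)) ∘ sym)
      ∷ Unique.++⁺ (common-unique u v) (exclusive-unique u v)
        λ (p , q) → proj₁ (proj₂ (∈-exclusive⁻ q)) (proj₂ (∈-common⁻ p))
    ⊆nbrs : v ∷ common u v ++ exclusive u v ⊆ nbrs u
    ⊆nbrs (here refl) = ∈-nbrs⁺ uv
    ⊆nbrs (there p)   = ∈-nbrs⁺ (Sum.[ proj₁ ∘ ∈-common⁻ , proj₁ ∘ ∈-exclusive⁻ ]
      (∈-++⁻ (common u v) p))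

  -- Exclusive neighbours are non-neighbours of v within the neighbourhood of u, where the
  -- complement is a matching.
  exclusive≤1 : ∀ {u v} → CoMatching G u → u ~ v → length (exclusive u v) ≤ 1
  exclusive≤1 {u} {v} co uv = bound (exclusive u v) (exclusive-unique u v) ∈-exclusive⁻
    where
    bound : ∀ ws → Unique ws → (∀ {w} → w ∈ ws → u ~ w × ¬ (v ~ w) × w ≢ v) → length ws ≤ 1
    bound [] _ _ = z≤n
    bound (x ∷ []) _ _ = s≤s z≤n
    bound (x ∷ y ∷ _) ((x≢y ∷ _) ∷ _) p =
      let ux , ¬vx , x≢v = p (here refl) ; uy , ¬vy , y≢v = p (there (here refl)) in
      contradiction ¬vy (co ux uv uy x≢v (y≢v ∘ sym) x≢y ¬vx)

  Low : Fin n → Set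
  Low v = deg v ≤ 6

  low? : ∀ v → Dec (Low v)
  low? v = deg v ℕ.≤? 6

  lows highs : Fin n → List (Fin n)
  lows v = filter low? (nbrs v)
  highs v = filter (¬? ∘ low?) (nbrs v)

  ∈-lows⁺ : ∀ {v w} → v ~ w → Low w → w ∈ lows v
  ∈-lows⁺ vw = ∈-filter⁺ low? (∈-nbrs⁺ vw)

  ∈-lows⁻ : ∀ {v w} → w ∈ lows v → v ~ w × Low w
  ∈-lows⁻ {v} w∈ = let p , q = ∈-filter⁻ low? {xs = nbrs v} w∈ in ∈-nbrs⁻ p , q

  ∈-highs⁺ : ∀ {v w} → v ~ w → ¬ Low w → w ∈ highs v
  ∈-highs⁺ vw = ∈-filter⁺ (¬? ∘ low?) (∈-nbrs⁺ vw)

  ∈-highs⁻ : ∀ {v w} → w ∈ highs v → v ~ w × ¬ Low w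
  ∈-highs⁻ {v} w∈ = let p , q = ∈-filter⁻ (¬? ∘ low?) {xs = nbrs v} w∈ in ∈-nbrs⁻ p , q

  lows-unique : ∀ v → Unique (lows v)
  lows-unique v = Unique.filter⁺ low? (nbrs-unique v)

  highs-unique : ∀ v → Unique (highs v)
  highs-unique v = Unique.filter⁺ (¬? ∘ low?) (nbrs-unique v)

  deg≡highs+lows : ∀ v → deg v ≡ length (highs v) + length (lows v)
  deg≡highs+lows v = trans
    (unique-⊆-⊇⇒length≡ (nbrs-unique v)
      (Unique.++⁺ (highs-unique v) (lows-unique v)
        λ (p , q) → proj₂ (∈-highs⁻ p) (proj₂ (∈-lows⁻ q)))
      split⊇ (Sum.[ ∈-nbrs⁺ ∘ proj₁ ∘ ∈-highs⁻ , ∈-nbrs⁺ ∘ proj₁ ∘ ∈-lows⁻ ] ∘ ∈-++⁻ (highs v)))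
    (length-++ (highs v))
    where
    split⊇ : nbrs v ⊆ highs v ++ lows v
    split⊇ {w} w∈ with low? w
    ... | yes low = ∈-++⁺ʳ (highs v) (∈-lows⁺ (∈-nbrs⁻ w∈) low)
    ... | no high = ∈-++⁺ˡ (∈-highs⁺ (∈-nbrs⁻ w∈) high)

  degreeSum≤ : ∑[ v < n ] deg v ≤ 2 * length (edges G)
  degreeSum≤ = begin
    ∑[ v < n ] deg v
      ≡⟨ length-filter-cartesianProduct (λ (u , v) → u ~? v) id (allFin n) ⟨
    length darts
      ≤⟨ unique-⊆⇒length≤ (Unique.filter⁺ adjacent?
           (Unique.cartesianProduct⁺ (Unique.allFin⁺ n) (Unique.allFin⁺ n))) darts⊆ ⟩
    length (edges G ++ map swap (edges G))
      ≡⟨ length-++ (edges G) ⟩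
    length (edges G) + length (map swap (edges G))
      ≡⟨ cong (λ k → length (edges G) + k)
           (trans (length-map swap (edges G)) (sym (ℕ.+-identityʳ _))) ⟩
    2 * length (edges G) ∎
    where
    open ℕ.≤-Reasoning
    adjacent? : ∀ e → Dec (uncurry _~_ e)
    adjacent? (u , v) = u ~? v
    darts = filter adjacent? (cartesianProduct (allFin n) (allFin n))
    darts⊆ : darts ⊆ edges G ++ map swap (edges G)
    darts⊆ e∈ with ∈ᵁ-edges {G = G}
      (proj₂ (∈-filter⁻ adjacent? {xs = cartesianProduct (allFin n) (allFin n)} e∈))
    ... | inj₁ p = ∈-++⁺ˡ p
    ... | inj₂ p = ∈-++⁺ʳ (edges G) (∈-map⁺ swap p)

  nonisolated? : ∀ v → Dec (1 ≤ deg v)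
  nonisolated? v = 1 ℕ.≤? deg v

  -- The vertex set of the subgraph that witnesses a large `mad`: isolated vertices would only lower
  -- its average degree.
  nonisolated : List (Fin n)
  nonisolated = filter nonisolated? (allFin n)

module Irreducible {G : SimpleGraph n} (irreducible : ¬ Reduction G) where
  open SimpleGraph G
  open Neighbourhood G

  -- The neighbours come as a list `ws` instead of `nbrs v`, so that callers can choose their order
  -- and match on the list until its length is a numeral.
  star-refute : ∀ {v ws} → Unique ws → (∀ {w} → w ∈ ws → v ~ w) → (∀ {w} → v ~ w → w ∈ ws) →
    ∀ {N} t → Refutes {suc (length ws)} spokes [] spokes N t →
    All (λ (i , j) → ¬ (lookup (v ∷ ws) i ~ lookup (v ∷ ws) j)) N → ⊥
  star-refute {v} {ws} unique ws⊆ ⊆ws t t-ok = Chart.refute irreducible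
    (lookup (v ∷ ws)) (lookup-injective (All.tabulate (~⇒≢ ∘ ws⊆) ∷ unique)) {B = []}
    (All.map⁺ (All.tabulate λ _ vw _ → ∈⇒lookup (there (⊆ws vw)))) [] t t-ok
    (All.map⁺ (All.tabulate λ {i} _ → ws⊆ (∈-lookup i)))

  deg≥5 : ∀ {v w} → v ~ w → 5 ≤ deg v
  deg≥5 {v} vw = bound (nbrs v) (nbrs-unique v) ∈-nbrs⁻ ∈-nbrs⁺ (∈-nbrs⁺ vw)
    where
    bound : ∀ ws → Unique ws → (∀ {w} → w ∈ ws → v ~ w) → (∀ {w} → v ~ w → w ∈ ws) →
      ∀ {w} → w ∈ ws → 5 ≤ length ws
    bound (_ ∷ []) unique ws⊆ ⊆ws _ =
      ⊥-elim (star-refute unique ws⊆ ⊆ws (isolated 1F) oneTree-refutes [])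
    bound (_ ∷ _ ∷ []) unique ws⊆ ⊆ws _ =
      ⊥-elim (star-refute unique ws⊆ ⊆ws twoTree twoTree-refutes [])
    bound (_ ∷ _ ∷ _ ∷ []) unique ws⊆ ⊆ws _ =
      ⊥-elim (star-refute unique ws⊆ ⊆ws threeTree threeTree-refutes [])
    bound (_ ∷ _ ∷ _ ∷ _ ∷ []) unique ws⊆ ⊆ws _ =
      ⊥-elim (star-refute unique ws⊆ ⊆ws fourTree fourTree-refutes [])
    bound (_ ∷ _ ∷ _ ∷ _ ∷ _ ∷ ws) _ _ _ _ = ℕ.m≤m+n 5 (length ws)

  -- The neighbours are listed with y, x, z first, at the positions 1F, 2F, 3F of `pathNonEdges`. By
  -- `deg≥5` two or three others follow, which are the cases of `fiveTree` and `sixTree`.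
  deg≤6⇒coMatching : ∀ {v} → deg v ≤ 6 → CoMatching G v
  deg≤6⇒coMatching {v} d≤6 {x} {y} {z} vx vy vz x≢y y≢z x≢z ¬yx ¬yz =
    absurd rest unique ws⊆ ⊆ws length-ws
    where
    open DecMembership (Fin._≟_ {n}) using (_∉?_)
    chosen = y ∷ x ∷ z ∷ []
    rest = filter (_∉? chosen) (nbrs v)
    ∈-rest⁻ : ∀ {w} → w ∈ rest → v ~ w × w ∉ chosen
    ∈-rest⁻ w∈ = let p , q = ∈-filter⁻ (_∉? chosen) {xs = nbrs v} w∈ in ∈-nbrs⁻ p , q
    unique : Unique (chosen ++ rest)
    unique = Unique.++⁺
      (((x≢y ∘ sym) ∷ y≢z ∷ []) ∷ (x≢z ∷ []) ∷ [] ∷ [])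
      (Unique.filter⁺ (_∉? chosen) (nbrs-unique v))
      λ (p , q) → proj₂ (∈-rest⁻ q) p
    ws⊆ : ∀ {w} → w ∈ chosen ++ rest → v ~ w
    ws⊆ w∈ with ∈-++⁻ chosen w∈
    ... | inj₁ w∈chosen = All.lookup {P = v ~_} (vy ∷ vx ∷ vz ∷ []) w∈chosen
    ... | inj₂ w∈rest   = proj₁ (∈-rest⁻ w∈rest)
    ⊆ws : ∀ {w} → v ~ w → w ∈ chosen ++ rest
    ⊆ws {w} vw with w ∉? chosen
    ... | yes w∉ = ∈-++⁺ʳ chosen (∈-filter⁺ (_∉? chosen) (∈-nbrs⁺ vw) w∉)
    ... | no ¬w∉ = ∈-++⁺ˡ (decidable-stable (DecMembership._∈?_ Fin._≟_ w chosen) ¬w∉)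
    length-ws : length (chosen ++ rest) ≡ deg v
    length-ws = unique-⊆-⊇⇒length≡ unique (nbrs-unique v) (∈-nbrs⁺ ∘ ws⊆) (⊆ws ∘ ∈-nbrs⁻)
    absurd : ∀ rest → Unique (chosen ++ rest) → (∀ {w} → w ∈ chosen ++ rest → v ~ w) →
      (∀ {w} → v ~ w → w ∈ chosen ++ rest) → length (chosen ++ rest) ≡ deg v → ⊥
    absurd [] _ _ _ eq = case subst (5 ≤_) (sym eq) (deg≥5 vx) of λ { (s≤s (s≤s (s≤s ()))) }
    absurd (_ ∷ []) _ _ _ eq =
      case subst (5 ≤_) (sym eq) (deg≥5 vx) of λ { (s≤s (s≤s (s≤s (s≤s ())))) }
    absurd (_ ∷ _ ∷ []) unique ws⊆ ⊆ws _ =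
      star-refute unique ws⊆ ⊆ws fiveTree fiveTree-refutes (¬yx ∷ ¬yz ∷ [])
    absurd (_ ∷ _ ∷ _ ∷ []) unique ws⊆ ⊆ws _ =
      star-refute unique ws⊆ ⊆ws sixTree sixTree-refutes (¬yx ∷ ¬yz ∷ [])
    absurd (_ ∷ _ ∷ _ ∷ _ ∷ _) _ _ _ eq =
      case subst (_≤ 6) (sym eq) d≤6 of λ { (s≤s (s≤s (s≤s (s≤s (s≤s (s≤s ())))))) }

  -- Two adjacent vertices of degree at most 6

  Fits : ∀ (u v : Fin n) C A B → PairCertificate (length (C ++ A ++ B)) → Set
  Fits u v C A B cert = map ρ shared ≡ C × map ρ only₀ ≡ A × map ρ only₁ ≡ B
    where
    open PairCertificate cert
    ρ = lookup (u ∷ v ∷ C ++ A ++ B)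

  pair-refute : ∀ {u v} C A B → u ~ v → CoMatching G u → CoMatching G v →
    All (λ w → u ~ w × v ~ w) C → All (λ w → u ~ w × ¬ (v ~ w)) A →
    All (λ w → v ~ w × ¬ (u ~ w)) B → Unique (u ∷ v ∷ C ++ A ++ B) →
    (∀ {w} → u ~ w → w ∈ v ∷ C ++ A) → (∀ {w} → v ~ w → w ∈ u ∷ C ++ B) →
    (cert : PairCertificate (length (C ++ A ++ B))) → Fits u v C A B cert → ⊥
  pair-refute {u} {v} C A B uv co-u co-v C-adj A-adj B-adj unique u-nbrs v-nbrs
    cert (c≡ , a≡ , b≡) =
    Chart.refute irreducible ρ (lookup-injective unique)
      (All.++⁺ {xs = spokes}
        (All.map⁺ (All.tabulate λ _ uw _ → ∈⇒lookup (there (at-u (u-nbrs uw)))))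
        (All.map⁺ (All.tabulate λ _ vw _ → ∈⇒lookup (at-v (v-nbrs vw)))))
      (co-u ∷ co-v ∷ []) tree refutes
      (uv ∷ All.++⁺ (All.map⁺ (All.map proj₁ c-adj)) (All.++⁺ (All.map⁺ (All.map proj₂ c-adj))
        (All.++⁺ (All.map⁺ (All.map proj₁ a-adj)) (All.map⁺ (All.map proj₁ b-adj)))))
      (All.++⁺ (All.map⁺ (All.map proj₂ a-adj)) (All.map⁺ (All.map proj₂ b-adj)))
    where
    open PairCertificate cert
    ρ = lookup (u ∷ v ∷ C ++ A ++ B)
    pull : ∀ {Q : Fin n → Set} {is ws} → map ρ is ≡ ws → All Q ws → All (Q ∘ ρ) is
    pull {Q} eq = All.map⁻ ∘ subst (All Q) (sym eq)
    c-adj = pull c≡ C-adj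
    a-adj = pull a≡ A-adj
    b-adj = pull b≡ B-adj
    at-u : ∀ {w} → w ∈ v ∷ C ++ A → w ∈ v ∷ C ++ A ++ B
    at-u (here eq) = here eq
    at-u (there p) = there (Sum.[ ∈-++⁺ˡ , ∈-++⁺ʳ C ∘ ∈-++⁺ˡ ] (∈-++⁻ C p))
    at-v : ∀ {w} → w ∈ u ∷ C ++ B → w ∈ u ∷ v ∷ C ++ A ++ B
    at-v (here eq) = here eq
    at-v (there p) = there (there (Sum.[ ∈-++⁺ˡ , ∈-++⁺ʳ C ∘ ∈-++⁺ʳ A ] (∈-++⁻ C p)))

  -- Of the at least five neighbours of u, only v and at most one exclusive neighbour are not
  -- common.
  3≤common : ∀ {u v} → deg u ≤ 6 → u ~ v → 3 ≤ length (common u v)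
  3≤common {u} {v} d≤6 uv = ℕ.+-cancelʳ-≤ 2 3 (length (common u v)) (begin
    5                                                      ≤⟨ deg≥5 uv ⟩
    deg u                                                  ≡⟨ deg-split uv ⟩
    suc (length (common u v) + length (exclusive u v))     ≡⟨ ℕ.+-suc _ _ ⟨
    length (common u v) + suc (length (exclusive u v))     ≤⟨ ℕ.+-monoʳ-≤ _
      (s≤s (exclusive≤1 (deg≤6⇒coMatching d≤6) uv)) ⟩
    length (common u v) + 2                                ∎)
    where open ℕ.≤-Reasoning

  -- There are three to five common neighbours and at most one exclusive neighbour on each side.
  -- Both degrees being 5 or 6 leaves six configurations, one for each `PairCertificate`.
  deg≤6-independent : ∀ {u v} → deg u ≤ 6 → deg v ≤ 6 → ¬ (u ~ v)
  deg≤6-independent {u} {v} du dv uv = absurd (common u v) (exclusive u v) (exclusive v u)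
    (3≤common du uv)
    (subst (5 ≤_) (deg-split uv) (deg≥5 uv)) (subst (5 ≤_) deg-v (deg≥5 (~-sym uv)))
    (subst (_≤ 6) (deg-split uv) du) (subst (_≤ 6) deg-v dv)
    (exclusive≤1 co-u uv) (exclusive≤1 co-v (~-sym uv))
    (pair-refute (common u v) (exclusive u v) (exclusive v u) uv co-u co-v
      (All.tabulate ∈-common⁻)
      (All.tabulate λ p → let uw , ¬vw , _ = ∈-exclusive⁻ p in uw , ¬vw)
      (All.tabulate λ p → let vw , ¬uw , _ = ∈-exclusive⁻ p in vw , ¬uw)
      unique nbrs⊆ v-nbrs)
    where
    co-u = deg≤6⇒coMatching du
    co-v = deg≤6⇒coMatching dv
    common-swap : ∀ {w} → w ∈ common v u → w ∈ common u v
    common-swap p = let vw , uw = ∈-common⁻ p in ∈-common⁺ uw vw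
    deg-v : deg v ≡ suc (length (common u v) + length (exclusive v u))
    deg-v = trans (deg-split (~-sym uv)) (cong (λ k → suc (k + length (exclusive v u)))
      (unique-⊆-⊇⇒length≡ (common-unique v u) (common-unique u v) common-swap
        λ p → let uw , vw = ∈-common⁻ p in ∈-common⁺ vw uw))
    v-nbrs : ∀ {w} → v ~ w → w ∈ u ∷ common u v ++ exclusive v u
    v-nbrs vw with nbrs⊆ vw
    ... | here eq = here eq
    ... | there p = there (Sum.[ ∈-++⁺ˡ ∘ common-swap , ∈-++⁺ʳ (common u v) ]
      (∈-++⁻ (common v u) p))
    unique : Unique (u ∷ v ∷ common u v ++ exclusive u v ++ exclusive v u)
    unique =
      (~⇒≢ uv ∷ All.++⁺ (All.tabulate (~⇒≢ ∘ proj₁ ∘ ∈-common⁻))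
        (All.++⁺ (All.tabulate (~⇒≢ ∘ proj₁ ∘ ∈-exclusive⁻))
          (All.tabulate λ p → proj₂ (proj₂ (∈-exclusive⁻ p)) ∘ sym)))
      ∷ All.++⁺ (All.tabulate (~⇒≢ ∘ proj₂ ∘ ∈-common⁻))
        (All.++⁺ (All.tabulate λ p → proj₂ (proj₂ (∈-exclusive⁻ p)) ∘ sym)
          (All.tabulate (~⇒≢ ∘ proj₁ ∘ ∈-exclusive⁻)))
      ∷ Unique.++⁺ (common-unique u v)
        (Unique.++⁺ (exclusive-unique u v) (exclusive-unique v u)
          λ (p , q) → proj₁ (proj₂ (∈-exclusive⁻ q)) (proj₁ (∈-exclusive⁻ p)))
        λ (p , q) → Sum.[ (λ r → proj₁ (proj₂ (∈-exclusive⁻ r)) (proj₂ (∈-common⁻ p)))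
                        , (λ r → proj₁ (proj₂ (∈-exclusive⁻ r)) (proj₁ (∈-common⁻ p))) ]
                        (∈-++⁻ (exclusive u v) q)
    -- The three lists are generalised so that matching on them turns the index of the certificate
    -- into a numeral and the equations of `Fits` into `refl`.
    absurd : ∀ C A B → 3 ≤ length C →
      5 ≤ suc (length C + length A) → 5 ≤ suc (length C + length B) →
      suc (length C + length A) ≤ 6 → suc (length C + length B) ≤ 6 →
      length A ≤ 1 → length B ≤ 1 →
      (∀ cert → Fits u v C A B cert → ⊥) → ⊥
    absurd (_ ∷ [])     _ _ (s≤s ())
    absurd (_ ∷ _ ∷ []) _ _ (s≤s (s≤s ()))
    absurd _ (_ ∷ _ ∷ _) _ _ _ _ _ _ (s≤s ())
    absurd _ _ (_ ∷ _ ∷ _) _ _ _ _ _ _ (s≤s ())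
    absurd (_ ∷ _ ∷ _ ∷ []) [] _ _ 5≤4 = ⊥-elim (from-no (5 ℕ.≤? 4) 5≤4)
    absurd (_ ∷ _ ∷ _ ∷ []) _ [] _ _ 5≤4 = ⊥-elim (from-no (5 ℕ.≤? 4) 5≤4)
    absurd (_ ∷ _ ∷ _ ∷ []) (_ ∷ []) (_ ∷ []) _ _ _ _ _ _ _ k =
      k threeˡʳ-common (refl , refl , refl)
    absurd (_ ∷ _ ∷ _ ∷ _ ∷ []) [] [] _ _ _ _ _ _ _ k = k four-common (refl , refl , refl)
    absurd (_ ∷ _ ∷ _ ∷ _ ∷ []) (_ ∷ []) [] _ _ _ _ _ _ _ k = k fourˡ-common (refl , refl , refl)
    absurd (_ ∷ _ ∷ _ ∷ _ ∷ []) [] (_ ∷ []) _ _ _ _ _ _ _ k = k fourʳ-common (refl , refl , refl)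
    absurd (_ ∷ _ ∷ _ ∷ _ ∷ []) (_ ∷ []) (_ ∷ []) _ _ _ _ _ _ _ k =
      k fourˡʳ-common (refl , refl , refl)
    absurd (_ ∷ _ ∷ _ ∷ _ ∷ _ ∷ []) (_ ∷ []) _ _ _ _ 7≤6 = ⊥-elim (from-no (7 ℕ.≤? 6) 7≤6)
    absurd (_ ∷ _ ∷ _ ∷ _ ∷ _ ∷ []) _ (_ ∷ []) _ _ _ _ 7≤6 = ⊥-elim (from-no (7 ℕ.≤? 6) 7≤6)
    absurd (_ ∷ _ ∷ _ ∷ _ ∷ _ ∷ []) [] [] _ _ _ _ _ _ _ k = k five-common (refl , refl , refl)
    absurd (_ ∷ _ ∷ _ ∷ _ ∷ _ ∷ _ ∷ C) A _ _ _ _ 7≤6 =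
      ⊥-elim (from-no (7 ℕ.≤? 6) (ℕ.≤-trans (ℕ.m≤m+n 7 (length C + length A)) 7≤6))

  -- Low neighbours of a high vertex

  common⊆highs : ∀ {u v} → u ~ v → Low v → common v u ⊆ highs u
  common⊆highs uv low-v w∈ =
    let vw , uw = ∈-common⁻ w∈ in ∈-highs⁺ uw λ low-w → deg≤6-independent low-v low-w vw

  low⇒3≤highs : ∀ {u v} → u ~ v → Low v → 3 ≤ length (highs u)
  low⇒3≤highs {u} {v} uv low-v = ℕ.≤-trans (3≤common low-v (~-sym uv))
    (unique-⊆⇒length≤ (common-unique v u) (common⊆highs uv low-v))

  -- The common neighbours of u and v number at least three and lie among the at most three high
  -- neighbours of u, so they exhaust them.
  3highs⇒complete : ∀ {u v w} → length (highs u) ≤ 3 → v ∈ lows u → w ∈ highs u → w ~ v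
  3highs⇒complete {u} {v} h≤3 v∈ w∈ = let uv , low-v = ∈-lows⁻ v∈ in
    ~-sym (proj₁ (∈-common⁻ (unique-⊆-length≥⇒⊇ Fin._≟_ (common-unique v u)
      (common⊆highs uv low-v) (ℕ.≤-trans h≤3 (3≤common low-v (~-sym uv))) w∈)))

  -- Three low neighbours would be independent and joined to all three high ones, which is the
  -- configuration of `lowTree`.
  3highs⇒lows≤2 : ∀ u → length (highs u) ≡ 3 → length (lows u) ≤ 2
  3highs⇒lows≤2 u h≡3 = bound (highs u) (lows u) h≡3 (highs-unique u) (lows-unique u)
    ∈-highs⁻ ∈-highs⁺ ∈-lows⁻ (3highs⇒complete (ℕ.≤-reflexive h≡3))
    where
    bound : ∀ H L → length H ≡ 3 → Unique H → Unique L →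
      (∀ {w} → w ∈ H → u ~ w × ¬ Low w) → (∀ {w} → u ~ w → ¬ Low w → w ∈ H) →
      (∀ {w} → w ∈ L → u ~ w × Low w) → (∀ {v w} → v ∈ L → w ∈ H → w ~ v) → length L ≤ 2
    bound _ [] _ _ _ _ _ _ _ = z≤n
    bound _ (_ ∷ []) _ _ _ _ _ _ _ = s≤s z≤n
    bound _ (_ ∷ _ ∷ []) _ _ _ _ _ _ _ = s≤s (s≤s z≤n)
    bound H@(h₁ ∷ h₂ ∷ h₃ ∷ []) (l₁ ∷ l₂ ∷ l₃ ∷ _) _ H-unique
      ((l₁≢l₂ ∷ l₁≢l₃ ∷ _) ∷ (l₂≢l₃ ∷ _) ∷ _) H⊆ ⊆H L⊆ complete =
      ⊥-elim (Chart.refute irreducible (lookup (u ∷ H ++ L′)) (lookup-injective unique) {B = []}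
        (closed (here refl) ∷ closed (there (here refl)) ∷
          closed (there (there (here refl))) ∷ [])
        [] lowTree lowTree-refutes
        (All.++⁺ {xs = spokes {6}} (All.map⁺ {f = λ i → 0F , Fin.suc i}
            (All.tabulate λ {i} _ → ⊆u (∈-lookup {xs = H ++ L′} i)))
          (complete (here refl) (here refl) ∷
           complete (there (here refl)) (there (here refl)) ∷
           complete (there (there (here refl))) (there (there (here refl))) ∷ []))
        (apart (here refl) (there (here refl)) ∷
         apart (here refl) (there (there (here refl))) ∷
         apart (there (here refl)) (there (there (here refl))) ∷ []))
      where
      L′ = l₁ ∷ l₂ ∷ l₃ ∷ []
      L′⊆ : ∀ {w} → w ∈ L′ → u ~ w × Low w
      L′⊆ = L⊆ ∘ ∈-++⁺ˡ
      ⊆u : ∀ {w} → w ∈ H ++ L′ → u ~ w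
      ⊆u = Sum.[ proj₁ ∘ H⊆ , proj₁ ∘ L′⊆ ] ∘ ∈-++⁻ H
      apart : ∀ {v w} → v ∈ L′ → w ∈ L′ → ¬ (v ~ w)
      apart v∈ w∈ = deg≤6-independent (proj₂ (L′⊆ v∈)) (proj₂ (L′⊆ w∈))
      unique : Unique (u ∷ H ++ L′)
      unique = All.tabulate (~⇒≢ ∘ ⊆u) ∷ Unique.++⁺ H-unique
        ((l₁≢l₂ ∷ l₁≢l₃ ∷ []) ∷ (l₂≢l₃ ∷ []) ∷ [] ∷ [])
        λ (p , q) → proj₂ (H⊆ p) (proj₂ (L′⊆ q))
      -- u may have further low neighbours outside the chart, but by independence none of them is
      -- adjacent to v.
      closed : ∀ {v} → v ∈ L′ → ∀ {w} → u ~ w → v ~ w → ∃ λ k → w ≡ lookup (u ∷ H ++ L′) k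
      closed v∈ uw vw = ∈⇒lookup (there (∈-++⁺ˡ (⊆H uw λ low-w →
        deg≤6-independent (proj₂ (L′⊆ v∈)) low-w vw)))

  -- A low neighbour forces three high neighbours. Exactly three would allow at most two low ones,
  -- hence degree at most 5, so there are at least four.
  lows-bound : ∀ u → ¬ Low u → length (lows u) ≤ 0 ⊎ 4 + length (lows u) ≤ deg u
  lows-bound u high with lows u in eq
  ... | [] = inj₁ z≤n
  ... | v ∷ L = inj₂ (subst (λ L → 4 + length L ≤ deg u) eq bound)
    where
    open ℕ.≤-Reasoning
    3≤h : 3 ≤ length (highs u)
    3≤h = let uv , low = ∈-lows⁻ (subst (v ∈_) (sym eq) (here refl)) in low⇒3≤highs uv low
    h≢3 : length (highs u) ≢ 3
    h≢3 h≡3 = high (begin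
      deg u                                ≡⟨ deg≡highs+lows u ⟩
      length (highs u) + length (lows u)   ≡⟨ cong (_+ length (lows u)) h≡3 ⟩
      3 + length (lows u)                  ≤⟨ ℕ.+-monoʳ-≤ 3 (3highs⇒lows≤2 u h≡3) ⟩
      5                                    ≤⟨ ℕ.n≤1+n 5 ⟩
      6                                    ∎)
    bound : 4 + length (lows u) ≤ deg u
    bound = begin
      4 + length (lows u)                  ≤⟨ ℕ.+-monoˡ-≤ _ (ℕ.≤∧≢⇒< 3≤h (h≢3 ∘ sym)) ⟩
      length (highs u) + length (lows u)   ≡⟨ deg≡highs+lows u ⟨
      deg u                                ∎

  -- The degree is at least 7. Without low neighbours 4 · 7 = 28 suffices; otherwise one copy of the
  -- degree covers 4 plus the number of low neighbours, and the other three give 3 · 7 = 21.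
  high⇒surplus : ∀ u → ¬ Low u → 25 + length (lows u) ≤ 4 * deg u
  high⇒surplus u high with lows-bound u high
  ... | inj₁ none = begin
    25 + length (lows u) ≤⟨ ℕ.+-monoʳ-≤ 25 none ⟩
    25                   ≤⟨ ℕ.m≤m+n 25 3 ⟩
    4 * 7                ≤⟨ ℕ.*-monoʳ-≤ 4 (ℕ.≰⇒> high) ⟩
    4 * deg u            ∎
    where open ℕ.≤-Reasoning
  ... | inj₂ some = begin
    25 + length (lows u)         ≡⟨ ℕ.+-comm (3 * 7 + 4) (length (lows u)) ⟩
    length (lows u) + (4 + 3 * 7) ≡⟨ ℕ.+-assoc (length (lows u)) 4 21 ⟨
    length (lows u) + 4 + 3 * 7  ≡⟨ cong (_+ 3 * 7) (ℕ.+-comm _ 4) ⟩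
    4 + length (lows u) + 3 * 7  ≤⟨ ℕ.+-mono-≤ some (ℕ.*-monoʳ-≤ 3 (ℕ.≰⇒> high)) ⟩
    deg u + 3 * deg u            ∎
    where open ℕ.≤-Reasoning

  -- Discharging

  send? : ∀ v w → Dec (Low v × v ~ w)
  send? v w = low? v ×-dec v ~? w

  -- What is sent is a claim for a quarter: `sent v` is four times the charge that v gains if it is
  -- low, and `received v` is four times the charge that v gives to its low neighbours.
  sent received : Fin n → ℕ
  sent v = length (filter (send? v) (allFin n))
  received v = length (filter (λ w → send? w v) (allFin n))

  private
    received-from : ∀ {v w} → w ∈ filter (λ w → send? w v) (allFin n) → Low w × w ~ v
    received-from {v} = proj₂ ∘ ∈-filter⁻ (λ w → send? w v) {xs = allFin n}

    received≤ : ∀ {v ws} → (∀ {w} → Low w → w ~ v → w ∈ ws) → received v ≤ length ws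
    received≤ {v} sub = unique-⊆⇒length≤ (Unique.filter⁺ (λ w → send? w v) (Unique.allFin⁺ n))
      λ w∈ → let low , wv = received-from w∈ in sub low wv

    low⇒deg≤sent : ∀ {v} → Low v → deg v ≤ sent v
    low⇒deg≤sent {v} low = unique-⊆⇒length≤ (nbrs-unique v)
      λ w∈ → ∈-filter⁺ (send? v) (∈-allFin _) (low , ∈-nbrs⁻ w∈)

  -- Multiplied by 4: every low vertex is given 1/4 by each of its neighbours.
  charge : ∀ v → 1 ≤ deg v → 25 + received v ≤ 4 * deg v + sent v
  charge v d≥1 = case low? v of λ { (no high) → charge-high high ; (yes low) → charge-low low }
    where
    open ℕ.≤-Reasoning
    charge-high : ¬ Low v → 25 + received v ≤ 4 * deg v + sent v
    charge-high high = begin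
      25 + received v      ≤⟨ ℕ.+-monoʳ-≤ 25 (received≤ λ low wv → ∈-lows⁺ (~-sym wv) low) ⟩
      25 + length (lows v) ≤⟨ high⇒surplus v high ⟩
      4 * deg v            ≤⟨ ℕ.m≤m+n _ _ ⟩
      4 * deg v + sent v   ∎
    5≤d : 5 ≤ deg v
    5≤d = neighbour (nbrs v) ∈-nbrs⁻ d≥1
      where
      neighbour : ∀ ws → (∀ {w} → w ∈ ws → v ~ w) → 1 ≤ length ws → 5 ≤ deg v
      neighbour (_ ∷ _) adj _ = deg≥5 (adj (here refl))
    -- By independence no claim reaches a low vertex; its own five or more claims give 4 · 5 + 5 =
    -- 25.
    charge-low : Low v → 25 + received v ≤ 4 * deg v + sent v
    charge-low low = begin
      25 + received v     ≤⟨ ℕ.+-monoʳ-≤ 25 (received≤ {ws = []} λ low-w wv →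
                               ⊥-elim (deg≤6-independent low-w low wv)) ⟩
      4 * 5 + 5           ≤⟨ ℕ.+-mono-≤ (ℕ.*-monoʳ-≤ 4 5≤d) (ℕ.≤-trans 5≤d (low⇒deg≤sent low)) ⟩
      4 * deg v + sent v  ∎

  isolated-charge : ∀ v → deg v ≤ 0 → received v ≤ 4 * deg v + sent v
  isolated-charge v d≤0 = ℕ.≤-trans
    (received≤ {ws = nbrs v} λ _ wv → ∈-nbrs⁺ (~-sym wv)) (ℕ.≤-trans d≤0 z≤n)

  private
    weight : Fin n → ℕ
    weight v = 𝟙 (nonisolated? v)

    weighted-charge : ∀ v → 25 * weight v + received v ≤ 4 * deg v + sent v
    weighted-charge v = case nonisolated? v of λ where
      (yes d≥1) → subst (λ b → 25 * (if b then 1 else 0) + received v ≤ 4 * deg v + sent v)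
        (sym (dec-true (nonisolated? v) d≥1)) (charge v d≥1)
      (no d≱1) → subst (λ b → 25 * (if b then 1 else 0) + received v ≤ 4 * deg v + sent v)
        (sym (dec-false (nonisolated? v) d≱1)) (isolated-charge v (ℕ.≤-pred (ℕ.≰⇒> d≱1)))

    sum-received≡sum-sent : ∑[ v < n ] received v ≡ ∑[ v < n ] sent v
    sum-received≡sum-sent = begin
      ∑[ v < n ] received v
        ≡⟨ sum-cong-≗ (λ v → length-filter-tabulate (λ w → send? w v) id) ⟩
      ∑[ v < n ] ∑[ w < n ] 𝟙 (send? w v)
        ≡⟨ ∑-comm (λ v w → 𝟙 (send? w v)) ⟩
      ∑[ w < n ] ∑[ v < n ] 𝟙 (send? w v)
        ≡⟨ sum-cong-≗ (λ w → length-filter-tabulate (send? w) id) ⟨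
      ∑[ w < n ] sent w ∎
      where open ≡-Reasoning

  -- Summed over all vertices the transfers cancel, and the degrees add up to at most twice the
  -- number of edges. The inequality is in the cross-multiplied form that `/-mono-≤` expects.
  averageDegree≥25/4 : 25 * length nonisolated ≤ 2 * length (edges G) * 4
  averageDegree≥25/4 = ℕ.+-cancelʳ-≤ (∑[ v < n ] sent v) _ _ (begin
    25 * length nonisolated + ∑[ v < n ] sent v
      ≡⟨ cong₂ _+_
           (trans (cong (25 *_) (length-filter-tabulate nonisolated? id))
             (*-distribˡ-sum 25 weight))
           (sym sum-received≡sum-sent) ⟩
    ∑[ v < n ] (25 * weight v) + ∑[ v < n ] received v
      ≡⟨ ∑-distrib-+ (λ v → 25 * weight v) received ⟨
    ∑[ v < n ] (25 * weight v + received v)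
      ≤⟨ sum-mono-≤ weighted-charge ⟩
    ∑[ v < n ] (4 * deg v + sent v)
      ≡⟨ ∑-distrib-+ (λ v → 4 * deg v) sent ⟩
    ∑[ v < n ] (4 * deg v) + ∑[ v < n ] sent v
      ≡⟨ cong (_+ ∑[ v < n ] sent v)
           (trans (sym (*-distribˡ-sum 4 deg)) (ℕ.*-comm 4 (sum deg))) ⟩
    ∑[ v < n ] deg v * 4 + ∑[ v < n ] sent v
      ≤⟨ ℕ.+-monoˡ-≤ _ (ℕ.*-monoˡ-≤ 4 degreeSum≤) ⟩
    2 * length (edges G) * 4 + ∑[ v < n ] sent v ∎)
    where open ℕ.≤-Reasoning

-- Average degrees of subgraphs

_⊑_ : SimpleGraph n → SimpleGraph n → Set
G ⊑ H = ∀ {u v} → SimpleGraph._~_ G u v → SimpleGraph._~_ H u v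

-- The vertices and edges of this subgraph are filters of `allFin n` and `edges H`, so the pair is
-- among the candidates for `mad H`.
mad-bound : (G H : SimpleGraph n) → G ⊑ H → ∀ w ws → Neighbourhood.nonisolated G ≡ w ∷ ws →
  averageDegree ((w List⁺.∷ ws) , edges G) ≤ℚ mad H
mad-bound {n} G H G⊑H w ws eq = All.lookup (xs≤max _ _) (∈-map⁺ averageDegree
  (∈-filter⁺ isGraph? (∈-cartesianProduct⁺ W∈ F∈) ends∈))
  where
  open SimpleGraph G
  open Neighbourhood G
  open Data.List.Extrema (DecTotalOrder.totalOrder ℚ.≤-decTotalOrder) using (xs≤max)
  W∈ : w List⁺.∷ ws ∈ mapMaybe List⁺.fromList (sublists (allFin n))
  W∈ = Any.mapMaybe⁺ List⁺.fromList _ (Any.map⁺ (Any.map (λ { refl → Maybe.just refl })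
    (subst (_∈ sublists (allFin n)) eq (filter-∈-sublists nonisolated? (allFin n)))))
  F∈ : edges G ∈ sublists (edges H)
  F∈ = subst (_∈ sublists (edges H))
    (filter-filter (isEdge? G) (isEdge? H) (λ (u<v , uv) → u<v , G⊑H uv)
      (cartesianProduct (allFin n) (allFin n)))
    (filter-∈-sublists (isEdge? G) (edges H))
  ∈-W : ∀ {u v} → u ~ v → u ∈ w ∷ ws
  ∈-W {u} uv = subst (u ∈_) eq (∈-filter⁺ nonisolated? (∈-allFin u) (∈-length (∈-nbrs⁺ uv)))
  ends∈ : All (EndpointsIn (w ∷ ws)) (edges G)
  ends∈ = All.tabulate λ e∈ → let _ , uv = ∈-edges⁻ {G = G} e∈ in ∈-W uv , ∈-W (~-sym uv)

-- Induction on the number of edges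

edges-decrease : {G : SimpleGraph n} (R : Reduction G) →
  length (edges (G -ᴱ Reduction.removed R)) ℕ.< length (edges G)
edges-decrease {n} {G} R with Reduction.removed-edge R
... | (u , v) , e∈F , uv = Sum.[
    (λ p → shorter p λ q → proj₁ (proj₂ (proj₂ (∈-edges⁻ {G = G′} q))) e∈F) ,
    (λ p → shorter p λ q → proj₂ (proj₂ (proj₂ (∈-edges⁻ {G = G′} q))) e∈F) ]
  (∈ᵁ-edges {G = G} uv)
  where
  G′ = G -ᴱ Reduction.removed R
  shorter : ∀ {e} → e ∈ edges G → e ∉ edges G′ → length (edges G′) ℕ.< length (edges G)
  shorter e∈ e∉ = unique-⊆⇒length≤ (All.¬Any⇒All¬ _ e∉ ∷ edges-unique {G = G′}) λ where
    (here refl) → e∈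
    (there p)   → let u<v , uv , _ = ∈-edges⁻ {G = G′} p in ∈-edges⁺ {G = G} u<v uv

-- The existence of a `Reduction` is not decided, so the case distinction lives under a double
-- negation, which the final inequality sheds because it is decidable. `H` stays fixed and carries
-- the bound on `mad`, while `G` shrinks inside it.
¬¬tuzaPair : (H : SimpleGraph n) → mad H < + 25 / 4 →
  (G : SimpleGraph n) → Acc ℕ._<_ (length (edges G)) → G ⊑ H → ¬ ¬ TuzaPair G
¬¬tuzaPair {n} H mad<25/4 G (acc smaller) G⊑H ¬tuza = absurd (Neighbourhood.nonisolated G) refl
  where
  open SimpleGraph G
  open Neighbourhood G
  irreducible : ¬ Reduction G
  irreducible R = ¬¬tuzaPair H mad<25/4 (G -ᴱ Reduction.removed R)
    (smaller (edges-decrease R)) (λ uv → G⊑H (proj₁ uv)) (¬tuza ∘ tuzaPair-extend R)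
  absurd : ∀ W → nonisolated ≡ W → ⊥
  -- Without non-isolated vertices there are no triangles, and the empty packing and cover do.
  absurd [] eq = ¬tuza record
    { packing = [] ; cover = [] ; packing-⊆ = [] ; packing-disjoint = []
    ; cover-covers = λ (a , b , _ , ab , _) → case subst (a ∈_) eq
        (∈-filter⁺ nonisolated? (∈-allFin a) (∈-length (∈-nbrs⁺ (proj₁ ab)))) of λ ()
    ; cover-small = z≤n
    }
  absurd (w ∷ ws) eq = ℚ.<-irrefl refl (ℚ.<-≤-trans mad<25/4 (ℚ.≤-trans
    (/-mono-≤ 25 (2 * length (edges G)) 3 (length ws)
      (subst (λ W → 25 * length W ≤ 2 * length (edges G) * 4) eq
        (Irreducible.averageDegree≥25/4 irreducible)))
    (mad-bound G H G⊑H w ws eq)))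

theorem6p1 : (n : ℕ) (G : SimpleGraph n) → mad G < + 25 / 4 → τ G ≤ 2 * ν G
theorem6p1 n G mad<25/4 = decidable-stable (τ G ℕ.≤? 2 * ν G) λ τ≰2ν →
  ¬¬tuzaPair G mad<25/4 G (<-wellFounded _) (λ uv → uv) (τ≰2ν ∘ tuzaPair⇒τ≤2ν)
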